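{- Let $n\ge1$, $0\le k\le n$, $d\ge1$ be integers, and let $\varepsilon\ge0$, $\delta>0$ be reals. There is an $\mathbb{F}_2$-linear code of blocklength $n$, rate $k$ and distance $d$ with an $\varepsilon$-smooth local tester of soundness $\delta$ if and only if there is a Cayley graph $\mathcal{G}=\mathrm{Cay}(\mathbb{F}_2^h,\mathcal{D})$ (for some probability distribution $\mathcal{D}$ on $\mathbb{F}_2^h$) and a set $S=\{b_1,\dots,b_n\}$ of linear maps $b_i:\mathbb{F}_2^h\to\mathbb{F}_2$, spanning the space of all linear maps $\mathbb{F}_2^h\to\mathbb{F}_2$, satisfying: 1. $h=n-k$; 2. $S$ is $d$-wise linearly independent; 3. $\lambda(b_i)\ge1-2\varepsilon$ for $i=1,\dots,n$; 4. for every linear map $b:\mathbb{F}_2^h\to\mathbb{F}_2$, $\lambda(b)\le1-2\delta\cdot\mathrm{rank}_S(b)$.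
   Context: A code of blocklength $n$ is a linear subspace $\mathcal{C}\subseteq\mathbb{F}_2^n$; its rate is $k=\dim\mathcal{C}$; it has distance $d$ if every nonzero codeword has Hamming weight at least $d$. For $r\in\mathbb{F}_2^n$, $d(r,\mathcal{C})$ is the minimum Hamming distance from $r$ to a codeword. $\mathcal{C}^\perp=\{\alpha\in\mathbb{F}_2^n:\alpha\cdot c=0\ \forall c\in\mathcal{C}\}$. A local tester for $\mathcal{C}$ is a probability distribution $\mathcal{D}_0$ on $\mathcal{C}^\perp$. It is $\varepsilon$-smooth if $\Pr_{\alpha\leftarrow\mathcal{D}_0}[\alpha_i=1]\le\varepsilon$ for every $i\in[n]$, and has soundness $\delta$ if $\Pr_{\alpha\leftarrow\mathcal{D}_0}[\alpha\cdot r=1]\ge\delta\cdot d(r,\mathcal{C})$ for every $r\in\mathbb{F}_2^n$. For a probability distribution $\mathcal{D}$ on $\mathbb{F}_2^h$, $\mathrm{Cay}(\mathbb{F}_2^h,\mathcal{D})$ is the weighted graph on $\mathbb{F}_2^h$ with weight $\mathcal{D}(s)$ on the edge $(x,x+s)$. For a linear map $b:\mathbb{F}_2^h\to\mathbb{F}_2$, the function $\chi_b(x)=(-1)^{b(x)}$ is an eigenvector of the random-walk transition matrix, with eigenvalue $\lambda(b)=\mathbf{E}_{s\leftarrow\mathcal{D}}[\chi_b(s)]$. $S=\{b_1,\dots,b_n\}$ is regarded as an indexed family (repetitions allowed). It is $d$-wise linearly independent if every subfamily of fewer than $d$ of its members is linearly independent over $\mathbb{F}_2$. $\mathrm{rank}_S(b)=\min\{|T|:T\subseteq[n],\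 b=\sum_{i\in T}b_i\}$. -}

module Defs where

open import Algebra.Definitions.RawMonoid using (sum)
open import Algebra.Bundles using (module CommutativeMonoid; module CommutativeRing)
open import Algebra.Module.Bundles.Raw using (RawLeftModule)
open import Algebra.Module.Morphism.Structures using (module LeftModuleMorphisms)
import Algebra.Properties.CommutativeSemigroup as CommutativeSemigroupProperties
open import Data.Bool.Base using (Bool; true; false; _∧_; _xor_; if_then_else_)
open import Data.Bool.Properties
  using (xor-assoc; xor-same; ∧-distribˡ-xor; ∧-zeroʳ; ∧-commutativeMonoid; xor-∧-commutativeRing)
open import Data.Fin.Base using (Fin)
open import Data.Fin.Subset using (Subset; ⊤; ∣_∣; _∉_)
open import Data.Integer.Base using (+_)
open import Data.Nat.Base as ℕ using (ℕ; zero; suc; _⊔_)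
import Data.Nat.Properties as ℕ
open import Data.Product.Base using (Σ-syntax; ∃-syntax; _×_; _,_)
open import Data.Rational.Base as ℚ using (ℚ; 0ℚ; 1ℚ; ½)
import Data.Rational.Properties as ℚ
open import Data.Rational.Solver using (module +-*-Solver)
open import Data.Vec.Base using (Vec; []; _∷_; map; zipWith; replicate; lookup; foldr′)
open import Function.Base using (_∘_; id)
open import Level using (0ℓ)
open import Relation.Binary.PropositionalEquality
  using (_≡_; _≢_; _≗_; refl; sym; trans; cong; cong₂; subst)
open import Relation.Nullary.Negation using (¬_)
open import Relation.Unary using (Pred; _∈_)

-- Reals are Cauchy sequences of rationals; _≈ᴿ_ is their equality.

IsCauchy : (ℕ → ℚ) → Set
IsCauchy x = ∀ e → 0ℚ ℚ.< e →
  ∃[ N ] (∀ m n → N ℕ.≤ m → N ℕ.≤ n → ℚ.∣ x m ℚ.- x n ∣ ℚ.≤ e)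

record ℝ : Set where
  constructor mkℝ
  field
    seq    : ℕ → ℚ
    cauchy : IsCauchy seq

open ℝ public

infix  4 _≈ᴿ_ _≤ᴿ_ _<ᴿ_
infixl 6 _+ᴿ_ _-ᴿ_
infixl 7 _*ᴿ_
infix  8 -ᴿ_

_≈ᴿ_ : ℝ → ℝ → Set
x ≈ᴿ y = ∀ e → 0ℚ ℚ.< e →
  ∃[ N ] (∀ n → N ℕ.≤ n → ℚ.∣ seq x n ℚ.- seq y n ∣ ℚ.≤ e)

_≤ᴿ_ : ℝ → ℝ → Set
x ≤ᴿ y = ∀ e → 0ℚ ℚ.< e →
  ∃[ N ] (∀ n → N ℕ.≤ n → seq x n ℚ.≤ seq y n ℚ.+ e)

_<ᴿ_ : ℝ → ℝ → Set
x <ᴿ y = ∃[ e ] (0ℚ ℚ.< e ×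
  ∃[ N ] (∀ n → N ℕ.≤ n → seq x n ℚ.+ e ℚ.≤ seq y n))

fromℚ : ℚ → ℝ
fromℚ q = mkℝ (λ _ → q) λ e 0<e → 0 , λ _ _ _ _ →
  subst (ℚ._≤ e) (sym (cong ℚ.∣_∣ (ℚ.+-inverseʳ q))) (ℚ.<⇒≤ 0<e)

fromℕ : ℕ → ℝ
fromℕ n = fromℚ (+ n ℚ./ 1)

0ᴿ 1ᴿ 2ᴿ : ℝ
0ᴿ = fromℚ 0ℚ
1ᴿ = fromℚ 1ℚ
2ᴿ = fromℕ 2

private
  open +-*-Solver using (solve; _:+_; _:*_; _:-_; :-_; _:=_; con)
  open ℚ.≤-Reasoning

  cauchy-+ : ∀ x y → IsCauchy x → IsCauchy y → IsCauchy (λ n → x n ℚ.+ y n)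
  cauchy-+ x y cx cy e 0<e
    with cx (½ ℚ.* e) 0<½e | cy (½ ℚ.* e) 0<½e
    where
    0<½e : 0ℚ ℚ.< ½ ℚ.* e
    0<½e = ℚ.*-monoʳ-<-pos ½ 0<e
  ... | M , hx | N , hy = M ⊔ N , λ m n m≥ n≥ → begin
    ℚ.∣ (x m ℚ.+ y m) ℚ.- (x n ℚ.+ y n) ∣
      ≡⟨ cong ℚ.∣_∣ (solve 4 (λ a b c d → (a :+ b) :- (c :+ d) := (a :- c) :+ (b :- d))
                      refl (x m) (y m) (x n) (y n)) ⟩
    ℚ.∣ (x m ℚ.- x n) ℚ.+ (y m ℚ.- y n) ∣
      ≤⟨ ℚ.∣p+q∣≤∣p∣+∣q∣ (x m ℚ.- x n) (y m ℚ.- y n) ⟩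
    ℚ.∣ x m ℚ.- x n ∣ ℚ.+ ℚ.∣ y m ℚ.- y n ∣
      ≤⟨ ℚ.+-mono-≤ (hx m n (ℕ.m⊔n≤o⇒m≤o M N m≥) (ℕ.m⊔n≤o⇒m≤o M N n≥))
                    (hy m n (ℕ.m⊔n≤o⇒n≤o M N m≥) (ℕ.m⊔n≤o⇒n≤o M N n≥)) ⟩
    ½ ℚ.* e ℚ.+ ½ ℚ.* e
      ≡⟨ solve 1 (λ a → con ½ :* a :+ con ½ :* a := a) refl e ⟩
    e ∎

  cauchy-neg : ∀ x → IsCauchy x → IsCauchy (λ n → ℚ.- x n)
  cauchy-neg x cx e 0<e with cx e 0<e
  ... | N , hx = N , λ m n m≥ n≥ → begin
    ℚ.∣ (ℚ.- x m) ℚ.- (ℚ.- x n) ∣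
      ≡⟨ cong ℚ.∣_∣ (solve 2 (λ a b → (:- a) :- (:- b) := :- (a :- b)) refl (x m) (x n)) ⟩
    ℚ.∣ ℚ.- (x m ℚ.- x n) ∣
      ≡⟨ ℚ.∣-p∣≡∣p∣ (x m ℚ.- x n) ⟩
    ℚ.∣ x m ℚ.- x n ∣
      ≤⟨ hx m n m≥ n≥ ⟩
    e ∎

  cauchy-bounded : ∀ {x} → IsCauchy x →
    ∃[ B ] (0ℚ ℚ.< B × ∃[ N ] (∀ n → N ℕ.≤ n → ℚ.∣ x n ∣ ℚ.≤ B))
  cauchy-bounded {x} cx with cx 1ℚ (ℚ.positive⁻¹ 1ℚ)
  ... | N , hx = 1ℚ ℚ.+ ℚ.∣ x N ∣ , 0<B , N , λ n n≥ → begin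
    ℚ.∣ x n ∣
      ≡⟨ cong ℚ.∣_∣ (solve 2 (λ a b → a := (a :- b) :+ b) refl (x n) (x N)) ⟩
    ℚ.∣ (x n ℚ.- x N) ℚ.+ x N ∣
      ≤⟨ ℚ.∣p+q∣≤∣p∣+∣q∣ (x n ℚ.- x N) (x N) ⟩
    ℚ.∣ x n ℚ.- x N ∣ ℚ.+ ℚ.∣ x N ∣
      ≤⟨ ℚ.+-monoˡ-≤ ℚ.∣ x N ∣ (hx n N n≥ ℕ.≤-refl) ⟩
    1ℚ ℚ.+ ℚ.∣ x N ∣ ∎
    where
    0<B : 0ℚ ℚ.< 1ℚ ℚ.+ ℚ.∣ x N ∣
    0<B = ℚ.+-mono-<-≤ (ℚ.positive⁻¹ 1ℚ) (ℚ.0≤∣p∣ (x N))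

  *-mono-≤-∣∣ : ∀ p q {a b} → ℚ.∣ p ∣ ℚ.≤ a → ℚ.∣ q ∣ ℚ.≤ b → ℚ.∣ p ℚ.* q ∣ ℚ.≤ a ℚ.* b
  *-mono-≤-∣∣ p q {a} {b} p≤a q≤b = begin
    ℚ.∣ p ℚ.* q ∣          ≡⟨ ℚ.∣p*q∣≡∣p∣*∣q∣ p q ⟩
    ℚ.∣ p ∣ ℚ.* ℚ.∣ q ∣    ≤⟨ ℚ.*-monoʳ-≤-nonNeg ℚ.∣ q ∣ {{ℚ.∣-∣-nonNeg q}} p≤a ⟩
    a ℚ.* ℚ.∣ q ∣          ≤⟨ ℚ.*-monoˡ-≤-nonNeg a {{0≤a}} q≤b ⟩
    a ℚ.* b                ∎
    where
    0≤a : ℚ.NonNegative a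
    0≤a = ℚ.nonNegative (ℚ.≤-trans (ℚ.0≤∣p∣ p) p≤a)

  ∣ab-cd∣≤ : ∀ a b c d {A B e} →
    ℚ.∣ a ∣ ℚ.≤ A → ℚ.∣ d ∣ ℚ.≤ B → ℚ.∣ a ℚ.- c ∣ ℚ.≤ e → ℚ.∣ b ℚ.- d ∣ ℚ.≤ e →
    ℚ.∣ a ℚ.* b ℚ.- c ℚ.* d ∣ ℚ.≤ (A ℚ.+ B) ℚ.* e
  ∣ab-cd∣≤ a b c d {A} {B} {e} a≤ d≤ a-c≤ b-d≤ = begin
    ℚ.∣ a ℚ.* b ℚ.- c ℚ.* d ∣
      ≡⟨ cong ℚ.∣_∣ (solve 4 (λ a b c d → a :* b :- c :* d := a :* (b :- d) :+ d :* (a :- c))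
                      refl a b c d) ⟩
    ℚ.∣ a ℚ.* (b ℚ.- d) ℚ.+ d ℚ.* (a ℚ.- c) ∣
      ≤⟨ ℚ.∣p+q∣≤∣p∣+∣q∣ (a ℚ.* (b ℚ.- d)) (d ℚ.* (a ℚ.- c)) ⟩
    ℚ.∣ a ℚ.* (b ℚ.- d) ∣ ℚ.+ ℚ.∣ d ℚ.* (a ℚ.- c) ∣
      ≤⟨ ℚ.+-mono-≤ (*-mono-≤-∣∣ a (b ℚ.- d) a≤ b-d≤) (*-mono-≤-∣∣ d (a ℚ.- c) d≤ a-c≤) ⟩
    A ℚ.* e ℚ.+ B ℚ.* e
      ≡⟨ sym (ℚ.*-distribʳ-+ e A B) ⟩
    (A ℚ.+ B) ℚ.* e ∎

  divide : ∀ c e → 0ℚ ℚ.< c → 0ℚ ℚ.< e → ∃[ q ] (0ℚ ℚ.< q × c ℚ.* q ≡ e)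
  divide c e 0<c 0<e = c⁻¹ ℚ.* e , 0<c⁻¹e ,
    trans (sym (ℚ.*-assoc c c⁻¹ e))
      (trans (cong (ℚ._* e) (ℚ.*-inverseʳ c {{c≢0}})) (ℚ.*-identityˡ e))
    where
    c>0 : ℚ.Positive c
    c>0 = ℚ.positive 0<c
    c≢0 : ℚ.NonZero c
    c≢0 = ℚ.pos⇒nonZero c {{c>0}}
    c⁻¹ : ℚ
    c⁻¹ = (ℚ.1/ c) {{c≢0}}
    0<c⁻¹e : 0ℚ ℚ.< c⁻¹ ℚ.* e
    0<c⁻¹e = subst (ℚ._< c⁻¹ ℚ.* e) (ℚ.*-zeroʳ c⁻¹)
      (ℚ.*-monoʳ-<-pos c⁻¹ {{ℚ.1/pos⇒pos c {{c>0}}}} 0<e)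

  cauchy-* : ∀ x y → IsCauchy x → IsCauchy y → IsCauchy (λ n → x n ℚ.* y n)
  cauchy-* x y cx cy e 0<e =
    let
      A , 0<A , K , bx = cauchy-bounded cx
      B , 0<B , L , by = cauchy-bounded cy
      q , 0<q , Cq≡e   = divide (A ℚ.+ B) e (ℚ.+-mono-< 0<A 0<B) 0<e
      M , hx           = cx q 0<q
      N , hy           = cy q 0<q
    in (K ⊔ L) ⊔ (M ⊔ N) , λ m n m≥ n≥ →
      let
        KL≤ : ∀ {p} → (K ⊔ L) ⊔ (M ⊔ N) ℕ.≤ p → K ⊔ L ℕ.≤ p
        KL≤ = ℕ.m⊔n≤o⇒m≤o (K ⊔ L) (M ⊔ N)
        MN≤ : ∀ {p} → (K ⊔ L) ⊔ (M ⊔ N) ℕ.≤ p → M ⊔ N ℕ.≤ p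
        MN≤ = ℕ.m⊔n≤o⇒n≤o (K ⊔ L) (M ⊔ N)
      in subst (ℚ.∣ x m ℚ.* y m ℚ.- x n ℚ.* y n ∣ ℚ.≤_) Cq≡e
        (∣ab-cd∣≤ (x m) (y m) (x n) (y n)
          (bx m (ℕ.m⊔n≤o⇒m≤o K L (KL≤ m≥)))
          (by n (ℕ.m⊔n≤o⇒n≤o K L (KL≤ n≥)))
          (hx m n (ℕ.m⊔n≤o⇒m≤o M N (MN≤ m≥)) (ℕ.m⊔n≤o⇒m≤o M N (MN≤ n≥)))
          (hy m n (ℕ.m⊔n≤o⇒n≤o M N (MN≤ m≥)) (ℕ.m⊔n≤o⇒n≤o M N (MN≤ n≥))))

_+ᴿ_ : ℝ → ℝ → ℝ
x +ᴿ y = mkℝ (λ n → seq x n ℚ.+ seq y n) (cauchy-+ (seq x) (seq y) (cauchy x) (cauchy y))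

-ᴿ_ : ℝ → ℝ
-ᴿ x = mkℝ (λ n → ℚ.- seq x n) (cauchy-neg (seq x) (cauchy x))

_-ᴿ_ : ℝ → ℝ → ℝ
x -ᴿ y = x +ᴿ (-ᴿ y)

_*ᴿ_ : ℝ → ℝ → ℝ
x *ᴿ y = mkℝ (λ n → seq x n ℚ.* seq y n) (cauchy-* (seq x) (seq y) (cauchy x) (cauchy y))

-- 𝔽₂ is (Bool , _xor_ , _∧_).

𝔽₂^ : ℕ → Set
𝔽₂^ n = Vec Bool n

infixl 6 _⊕_

_⊕_ : ∀ {n} → 𝔽₂^ n → 𝔽₂^ n → 𝔽₂^ n
_⊕_ = zipWith _xor_

𝟎 : ∀ {n} → 𝔽₂^ n
𝟎 = replicate _ false

infix 7 _·_

_·_ : ∀ {n} → 𝔽₂^ n → 𝔽₂^ n → Bool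
x · y = foldr′ _xor_ false (zipWith _∧_ x y)

-- The Hamming weight of c is ∣ c ∣, the cardinality of c read as a `Subset n`.

hammingDistance : ∀ {n} → 𝔽₂^ n → 𝔽₂^ n → ℕ
hammingDistance x y = ∣ x ⊕ y ∣

-- Negation is the identity in characteristic 2.

scalars : RawLeftModule Bool 0ℓ 0ℓ
scalars = record
  { Carrierᴹ = Bool ; _≈ᴹ_ = _≡_ ; _+ᴹ_ = _xor_ ; _*ₗ_ = _∧_ ; 0ᴹ = false ; -ᴹ_ = id }

space : ℕ → RawLeftModule Bool 0ℓ 0ℓ
space n = record
  { Carrierᴹ = 𝔽₂^ n ; _≈ᴹ_ = _≡_ ; _+ᴹ_ = _⊕_ ; _*ₗ_ = λ a → map (a ∧_) ; 0ᴹ = 𝟎 ; -ᴹ_ = id }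

record LinearMap (h : ℕ) : Set where
  open LeftModuleMorphisms (space h) scalars
  field
    apply    : 𝔽₂^ h → Bool
    isLinear : IsLeftModuleHomomorphism apply
  open IsLeftModuleHomomorphism isLinear public

open LinearMap public using (apply)

private
  open CommutativeSemigroupProperties
    (CommutativeMonoid.commutativeSemigroup
      (CommutativeRing.+-commutativeMonoid xor-∧-commutativeRing))
    using () renaming (interchange to xor-interchange)
  open CommutativeSemigroupProperties
    (CommutativeMonoid.commutativeSemigroup ∧-commutativeMonoid)
    using () renaming (x∙yz≈y∙xz to ∧-leftComm)

mkLinear : ∀ {h} (f : 𝔽₂^ h → Bool) →
  (∀ x y → f (x ⊕ y) ≡ f x xor f y) → f 𝟎 ≡ false →
  (∀ a x → f (map (a ∧_) x) ≡ a ∧ f x) → LinearMap h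
mkLinear f f-+ f-0 f-* = record
  { apply = f
  ; isLinear = record
    { +ᴹ-isGroupHomomorphism = record
      { isMonoidHomomorphism = record
        { isMagmaHomomorphism = record
          { isRelHomomorphism = record { cong = cong f }
          ; homo = f-+
          }
        ; ε-homo = f-0
        }
      ; ⁻¹-homo = λ _ → refl
      }
    ; *ₗ-homo = f-*
    }
  }

dual : ℕ → RawLeftModule Bool 0ℓ 0ℓ
dual h = record
  { Carrierᴹ = LinearMap h
  ; _≈ᴹ_ = λ f g → apply f ≗ apply g
  ; _+ᴹ_ = λ f g → let open LinearMap in mkLinear (λ x → apply f x xor apply g x)
      (λ x y → trans (cong₂ _xor_ (+ᴹ-homo f x y) (+ᴹ-homo g x y))
                     (xor-interchange (apply f x) (apply f y) (apply g x) (apply g y)))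
      (cong₂ _xor_ (0ᴹ-homo f) (0ᴹ-homo g))
      (λ a x → trans (cong₂ _xor_ (*ₗ-homo f a x) (*ₗ-homo g a x))
                     (sym (∧-distribˡ-xor a (apply f x) (apply g x))))
  ; _*ₗ_ = λ c f → let open LinearMap in mkLinear (λ x → c ∧ apply f x)
      (λ x y → trans (cong (c ∧_) (+ᴹ-homo f x y)) (∧-distribˡ-xor c (apply f x) (apply f y)))
      (trans (cong (c ∧_) (0ᴹ-homo f)) (∧-zeroʳ c))
      (λ a x → trans (cong (c ∧_) (*ₗ-homo f a x)) (∧-leftComm c a (apply f x)))
  ; 0ᴹ = mkLinear (λ _ → false) (λ _ _ → refl) refl (λ a _ → sym (∧-zeroʳ a))
  ; -ᴹ_ = id
  }

module _ (V : RawLeftModule Bool 0ℓ 0ℓ) where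
  open RawLeftModule V

  -- For T : Subset n this is also the subset sum ∑_{i ∈ T} vᵢ.
  linearCombination : ∀ {n} → 𝔽₂^ n → (Fin n → Carrierᴹ) → Carrierᴹ
  linearCombination a v = sum +ᴹ-rawMonoid (λ i → lookup a i *ₗ v i)

  -- The subfamily (vᵢ)_{i ∈ T}: coefficients range over vectors supported on T.
  LinearlyIndependentOn : ∀ {n} → Subset n → (Fin n → Carrierᴹ) → Set
  LinearlyIndependentOn T v = ∀ a → (∀ i → i ∉ T → lookup a i ≡ false) →
    linearCombination a v ≈ᴹ 0ᴹ → ∀ i → lookup a i ≡ false

  LinearlyIndependent : ∀ {n} → (Fin n → Carrierᴹ) → Set
  LinearlyIndependent = LinearlyIndependentOn ⊤

  WiseIndependent : ∀ {n} → ℕ → (Fin n → Carrierᴹ) → Set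
  WiseIndependent d v = ∀ T → ∣ T ∣ ℕ.< d → LinearlyIndependentOn T v

  Spans : ∀ {n} → (Fin n → Carrierᴹ) → Pred Carrierᴹ 0ℓ → Set
  Spans v P = ∀ u → u ∈ P → ∃[ a ] linearCombination a v ≈ᴹ u

  record IsSubspace (P : Pred Carrierᴹ 0ℓ) : Set where
    field
      0∈ : 0ᴹ ∈ P
      +∈ : ∀ {u v} → u ∈ P → v ∈ P → (u +ᴹ v) ∈ P
      *∈ : ∀ a {u} → u ∈ P → (a *ₗ u) ∈ P

  HasDimension : Pred Carrierᴹ 0ℓ → ℕ → Set
  HasDimension P k = Σ[ v ∈ (Fin k → Carrierᴹ) ]
    ((∀ i → v i ∈ P) × LinearlyIndependent v × Spans v P)

-- IsMin P m says m = min P. Minima are given as relations since membership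
-- in a code, an arbitrary predicate, need not be decidable.
IsMin : Pred ℕ 0ℓ → ℕ → Set
IsMin P m = m ∈ P × (∀ j → j ∈ P → m ℕ.≤ j)

-- IsRank b f m says rank_S(f) = m for S = {b₁, …, bₙ}.
IsRank : ∀ {h n} → (Fin n → LinearMap h) → LinearMap h → ℕ → Set
IsRank {h} {n} b f = IsMin λ m →
  Σ[ T ∈ Subset n ] (linearCombination (dual h) T b ≈ᴹ f × ∣ T ∣ ≡ m)
  where open RawLeftModule (dual h)

∑ : ∀ {n} → (𝔽₂^ n → ℝ) → ℝ
∑ {zero}  f = f []
∑ {suc n} f = ∑ (λ x → f (false ∷ x)) +ᴿ ∑ (λ x → f (true ∷ x))

record Distribution (n : ℕ) : Set where
  field
    prob   : 𝔽₂^ n → ℝ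
    nonNeg : ∀ x → 0ᴿ ≤ᴿ prob x
    total  : ∑ prob ≈ᴿ 1ᴿ

open Distribution public

Pr : ∀ {n} → Distribution n → (𝔽₂^ n → Bool) → ℝ
Pr 𝒟 P = ∑ λ x → if P x then prob 𝒟 x else 0ᴿ

𝐄 : ∀ {n} → Distribution n → (𝔽₂^ n → ℝ) → ℝ
𝐄 𝒟 f = ∑ λ x → prob 𝒟 x *ᴿ f x

record Code (n : ℕ) : Set₁ where
  field
    Codeword   : Pred (𝔽₂^ n) 0ℓ
    isSubspace : IsSubspace (space n) Codeword

open Code public

module _ {n} (C : Code n) where

  HasRate : ℕ → Set
  HasRate = HasDimension (space n) (Codeword C)

  HasDistance : ℕ → Set
  HasDistance d = ∀ c → c ∈ Codeword C → c ≢ 𝟎 → d ℕ.≤ ∣ c ∣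

  -- IsDistanceTo r m says d(r, C) = m.
  IsDistanceTo : 𝔽₂^ n → ℕ → Set
  IsDistanceTo r = IsMin λ m → ∃[ c ] (c ∈ Codeword C × hammingDistance r c ≡ m)

  Dual : Pred (𝔽₂^ n) 0ℓ
  Dual α = ∀ c → c ∈ Codeword C → α · c ≡ false

  -- A distribution on C^⊥, as a distribution on 𝔽₂ⁿ vanishing off C^⊥.
  record LocalTester : Set where
    field
      𝒟₀        : Distribution n
      supported : ∀ α → ¬ (α ∈ Dual) → prob 𝒟₀ α ≈ᴿ 0ᴿ

module _ {n} {C : Code n} (𝒯 : LocalTester C) where
  open LocalTester 𝒯

  IsSmooth : ℝ → Set
  IsSmooth ε = ∀ i → Pr 𝒟₀ (λ α → lookup α i) ≤ᴿ ε

  HasSoundness : ℝ → Set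
  HasSoundness δ = ∀ r m → IsDistanceTo C r m → δ *ᴿ fromℕ m ≤ᴿ Pr 𝒟₀ (λ α → α · r)

record CayleyGraph (h : ℕ) : Set where
  constructor Cay
  field
    𝒟 : Distribution h

  -- The edge (x , x + s) has weight 𝒟(s), and x + y = s iff y = x + s.
  weight : 𝔽₂^ h → 𝔽₂^ h → ℝ
  weight x y = prob 𝒟 (x ⊕ y)

open CayleyGraph public

-- The transition matrix is the weight matrix, since its rows sum to 1.
randomWalk : ∀ {h} → CayleyGraph h → (𝔽₂^ h → ℝ) → 𝔽₂^ h → ℝ
randomWalk 𝒢 f x = ∑ λ y → weight 𝒢 x y *ᴿ f y

χ : ∀ {h} → LinearMap h → 𝔽₂^ h → ℝ
χ b x = if apply b x then -ᴿ 1ᴿ else 1ᴿ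

eigenvalue : ∀ {h} → CayleyGraph h → LinearMap h → ℝ
eigenvalue 𝒢 b = 𝐄 (𝒟 𝒢) (χ b)

private
  infix 4 _≐_

  _≐_ : ℝ → ℝ → Set
  x ≐ y = ∀ n → seq x n ≡ seq y n

  ≐⇒≈ : ∀ {x y} → x ≐ y → x ≈ᴿ y
  ≐⇒≈ {x} {y} p e 0<e = 0 , λ n _ →
    subst (ℚ._≤ e)
      (cong ℚ.∣_∣ (sym (trans (cong (λ t → t ℚ.- seq y n) (p n)) (ℚ.+-inverseʳ (seq y n)))))
      (ℚ.<⇒≤ 0<e)

  ∑-cong : ∀ {h} {f g : 𝔽₂^ h → ℝ} → (∀ x → f x ≐ g x) → ∑ f ≐ ∑ g
  ∑-cong {zero}  p   = p []
  ∑-cong {suc h} p n = cong₂ ℚ._+_ (∑-cong (p ∘ (false ∷_)) n) (∑-cong (p ∘ (true ∷_)) n)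

  ∑-translate : ∀ {h} (x : 𝔽₂^ h) f → ∑ f ≐ ∑ (λ s → f (x ⊕ s))
  ∑-translate []          f n = refl
  ∑-translate (false ∷ x) f n =
    cong₂ ℚ._+_ (∑-translate x (f ∘ (false ∷_)) n) (∑-translate x (f ∘ (true ∷_)) n)
  ∑-translate (true ∷ x)  f n =
    trans (ℚ.+-comm (seq (∑ (f ∘ (false ∷_))) n) _)
      (cong₂ ℚ._+_ (∑-translate x (f ∘ (true ∷_)) n) (∑-translate x (f ∘ (false ∷_)) n))

  ∑-*ʳ : ∀ {h} (f : 𝔽₂^ h → ℝ) c → ∑ (λ x → f x *ᴿ c) ≐ ∑ f *ᴿ c
  ∑-*ʳ {zero}  f c n = refl
  ∑-*ʳ {suc h} f c n =
    trans (cong₂ ℚ._+_ (∑-*ʳ (f ∘ (false ∷_)) c n) (∑-*ʳ (f ∘ (true ∷_)) c n))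
      (sym (ℚ.*-distribʳ-+ (seq c n) (seq (∑ (f ∘ (false ∷_))) n) (seq (∑ (f ∘ (true ∷_))) n)))

  ⊕-cancel : ∀ {h} (x s : 𝔽₂^ h) → x ⊕ (x ⊕ s) ≡ s
  ⊕-cancel []      []      = refl
  ⊕-cancel (a ∷ x) (b ∷ s) =
    cong₂ _∷_ (trans (sym (xor-assoc a a b)) (cong (_xor b) (xor-same a))) (⊕-cancel x s)

  sign : Bool → ℝ
  sign a = if a then -ᴿ 1ᴿ else 1ᴿ

  sign-xor : ∀ a b → sign (a xor b) ≐ sign b *ᴿ sign a
  sign-xor false false _ = refl
  sign-xor false true  _ = refl
  sign-xor true  false _ = refl
  sign-xor true  true  _ = refl

  ≐-trans : ∀ x y z → x ≐ y → y ≐ z → x ≐ z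
  ≐-trans x y z p q n = trans (p n) (q n)

  *-cong-≐ : ∀ x y u v → x ≡ y → u ≐ v → x *ᴿ u ≐ y *ᴿ v
  *-cong-≐ x .x u v refl q n = cong (seq x n ℚ.*_) (q n)

  *-assoc-≐ : ∀ x y z → x *ᴿ (y *ᴿ z) ≐ (x *ᴿ y) *ᴿ z
  *-assoc-≐ x y z n = sym (ℚ.*-assoc (seq x n) (seq y n) (seq z n))

  χ-⊕ : ∀ {h} (b : LinearMap h) x s → χ b (x ⊕ s) ≐ χ b s *ᴿ χ b x
  χ-⊕ b x s = subst (λ t → sign t ≐ χ b s *ᴿ χ b x) (sym (LinearMap.+ᴹ-homo b x s))
    (sign-xor (apply b x) (apply b s))

χ-isEigenvector : ∀ {h} (𝒢 : CayleyGraph h) b x →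
  randomWalk 𝒢 (χ b) x ≈ᴿ eigenvalue 𝒢 b *ᴿ χ b x
χ-isEigenvector 𝒢 b x = ≐⇒≈ {randomWalk 𝒢 (χ b) x} {eigenvalue 𝒢 b *ᴿ χ b x}
  (≐-trans (∑ F) (∑ (F ∘ (x ⊕_))) (eigenvalue 𝒢 b *ᴿ χ b x)
    (∑-translate x F)
    (≐-trans (∑ (F ∘ (x ⊕_))) (∑ (λ s → G s *ᴿ χ b x)) (∑ G *ᴿ χ b x)
      (∑-cong {f = F ∘ (x ⊕_)} {g = λ s → G s *ᴿ χ b x} term)
      (∑-*ʳ G (χ b x))))
  where
  F G : _ → ℝ
  F y = weight 𝒢 x y *ᴿ χ b y
  G s = prob (𝒟 𝒢) s *ᴿ χ b s
  term : ∀ s → F (x ⊕ s) ≐ G s *ᴿ χ b x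
  term s = ≐-trans (F (x ⊕ s)) (prob (𝒟 𝒢) s *ᴿ (χ b s *ᴿ χ b x)) (G s *ᴿ χ b x)
    (*-cong-≐ (weight 𝒢 x (x ⊕ s)) (prob (𝒟 𝒢) s) (χ b (x ⊕ s)) (χ b s *ᴿ χ b x)
      (cong (prob (𝒟 𝒢)) (⊕-cancel x s)) (χ-⊕ b x s))
    (*-assoc-≐ (prob (𝒟 𝒢) s) (χ b s) (χ b x))

{-# OPTIONS --safe #-}
-- Stack b₁, …, bₙ as the columns of an h × n matrix: spanning means full rank, so it is a
-- parity-check matrix of a code C of rate n − h.  The sets T with ∑_{i ∈ T} bᵢ = f then form a coset
-- r + C, whence rank_S(f) = d(r, C), and d-wise independence says that C has distance d.
-- A tester corresponds to a Cayley graph by pushing distributions forward along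
-- s ↦ (b₁(s), …, bₙ(s)), which maps 𝔽₂ʰ bijectively onto C^⊥, and along a left inverse of it.
-- Under this correspondence λ(f) = 1 − 2 Pr[f(s) = 1] = 1 − 2 Pr[α · r = 1].

module Submission where

open import Defs
import Algebra.Properties.CommutativeSemigroup as CommutativeSemigroupProperties
import Algebra.Properties.Semiring.Sum as Sum
open import Algebra.Bundles using (module CommutativeRing)
open import Algebra.Module.Bundles.Raw using (module RawLeftModule)
open import Data.Bool.Base using (Bool; true; false; _∧_; _xor_; if_then_else_)
import Data.Bool.Properties as 𝔹
open import Data.Fin.Base using (Fin; zero; suc; punchIn; punchOut)
import Data.Fin.Properties as Fin
open import Data.Fin.Subset using (Subset; ∣_∣; ⁅_⁆; _∉_; _⊆_)
open import Data.Fin.Subset.Properties using (∈⊤; p⊆q⇒∣p∣≤∣q∣; _∈?_)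
open import Data.Integer.Base using (+_)
open import Data.Nat.Base as ℕ using (ℕ; zero; suc; _≤_; _∸_; _⊔_)
import Data.Nat.Properties as ℕ
open import Data.Product.Base using (Σ-syntax; ∃-syntax; _×_; _,_; proj₁; proj₂)
open import Data.Rational.Base as ℚ using (ℚ; 0ℚ; 1ℚ; ½)
import Data.Rational.Properties as ℚ
open import Data.Rational.Solver using (module +-*-Solver)
open import Data.Vec.Base using ([]; _∷_; map; lookup; tabulate)
open import Data.Vec.Properties
  using (lookup-zipWith; lookup-replicate; lookup∘tabulate; tabulate∘lookup; tabulate-cong;
         map-id; map-const; []=⇒lookup; lookup⇒[]=; ≡-dec)
open import Function.Base using (_∘_; flip)
open import Function.Bundles using (_⇔_; mk⇔; module Equivalence)
open import Level using (0ℓ)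
open import Relation.Binary.Definitions using (DecidableEquality)
open import Relation.Binary.PropositionalEquality
  using (_≡_; _≢_; _≗_; refl; sym; trans; cong; cong₂; subst; module ≡-Reasoning)
open import Relation.Nullary using (¬_; yes; no; contradiction; does; decidable-stable)
open import Relation.Unary using (Pred; _∈_; U)

open LinearMap using (+ᴹ-homo; 0ᴹ-homo; *ₗ-homo)
open Equivalence using (to; from)

-- Both directions rest on one elimination, `complement`. A code is given by a basis of C, so the
-- rows of a parity-check matrix must be built: they are the coordinates along a complement of C. A
-- spanning family gives the matrix, so a basis of its kernel must be built: spanning supplies a
-- right inverse `u`, and a complement of span `u` is projected into the kernel. The map from 𝔽₂ⁿ
-- back to 𝔽₂ʰ inverts the embedding only on C^⊥, and a tester is known only to have probability
-- `≈ᴿ` 0 off C^⊥. Events are therefore compared up to null outcomes, in the contrapositive form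
-- that needs no decision of membership in C^⊥. Distances and ranks are never computed: the sets of
-- candidate values are shown to agree, and their minima follow.

private
  module 𝔽₂ = CommutativeRing 𝔹.xor-∧-commutativeRing
  module 𝔽₂-Sum = Sum 𝔽₂.semiring

  variable
    n h k : ℕ

open CommutativeSemigroupProperties 𝔽₂.+-commutativeSemigroup
  using () renaming (interchange to xor-interchange)
open CommutativeSemigroupProperties 𝔽₂.*-commutativeSemigroup
  using () renaming (x∙yz≈y∙xz to ∧-leftComm)

-- Vectors, pairings and linear maps over 𝔽₂

lookup-ext : {x y : 𝔽₂^ n} → lookup x ≗ lookup y → x ≡ y
lookup-ext {x = x} {y} x≗y =
  trans (sym (tabulate∘lookup x)) (trans (tabulate-cong x≗y) (tabulate∘lookup y))

⊕-self : (x : 𝔽₂^ n) → x ⊕ x ≡ 𝟎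
⊕-self []      = refl
⊕-self (a ∷ x) = cong₂ _∷_ (𝔹.xor-same a) (⊕-self x)

⊕-cancelʳ : (x y : 𝔽₂^ n) → (x ⊕ y) ⊕ y ≡ x
⊕-cancelʳ []      []      = refl
⊕-cancelʳ (a ∷ x) (b ∷ y) = cong₂ _∷_
  (trans (𝔹.xor-assoc a b b) (trans (cong (a xor_) (𝔹.xor-same b)) (𝔹.xor-identityʳ a)))
  (⊕-cancelʳ x y)

⊕-cancelˡ : (x y : 𝔽₂^ n) → x ⊕ (x ⊕ y) ≡ y
⊕-cancelˡ []      []      = refl
⊕-cancelˡ (a ∷ x) (b ∷ y) = cong₂ _∷_
  (trans (sym (𝔹.xor-assoc a a b)) (cong (_xor b) (𝔹.xor-same a)))
  (⊕-cancelˡ x y)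

x⊕y≡𝟎⇒x≡y : (x y : 𝔽₂^ n) → x ⊕ y ≡ 𝟎 → x ≡ y
x⊕y≡𝟎⇒x≡y x y eq = trans (sym (⊕-cancelʳ x y))
  (trans (cong (_⊕ y) (trans eq (sym (⊕-self y)))) (⊕-cancelʳ y y))

xor≡false⇒≡ : ∀ a b → a xor b ≡ false → a ≡ b
xor≡false⇒≡ false false _ = refl
xor≡false⇒≡ true  true  _ = refl

⟪_,_⟫ : 𝔽₂^ n → (Fin n → Bool) → Bool
⟪ a , g ⟫ = linearCombination scalars a g

⟪⟫-cong : (a : 𝔽₂^ n) {f g : Fin n → Bool} → f ≗ g → ⟪ a , f ⟫ ≡ ⟪ a , g ⟫
⟪⟫-cong a f≗g = 𝔽₂-Sum.sum-cong-≗ (λ i → cong (lookup a i ∧_) (f≗g i))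

⟪⟫-zeroʳ : (a : 𝔽₂^ n) {g : Fin n → Bool} → (∀ i → g i ≡ false) → ⟪ a , g ⟫ ≡ false
⟪⟫-zeroʳ []      g≗0 = refl
⟪⟫-zeroʳ (x ∷ a) g≗0 =
  cong₂ _xor_ (trans (cong (x ∧_) (g≗0 zero)) (𝔹.∧-zeroʳ x)) (⟪⟫-zeroʳ a (g≗0 ∘ suc))

⟪⟫-zeroˡ : (g : Fin n → Bool) → ⟪ 𝟎 , g ⟫ ≡ false
⟪⟫-zeroˡ {zero}  g = refl
⟪⟫-zeroˡ {suc n} g = ⟪⟫-zeroˡ (g ∘ suc)

⟪⟫-⊕ˡ : (g : Fin n → Bool) (a b : 𝔽₂^ n) → ⟪ a ⊕ b , g ⟫ ≡ ⟪ a , g ⟫ xor ⟪ b , g ⟫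
⟪⟫-⊕ˡ g []      []      = refl
⟪⟫-⊕ˡ g (x ∷ a) (y ∷ b) = trans
  (cong₂ _xor_ (𝔹.∧-distribʳ-xor (g zero) x y) (⟪⟫-⊕ˡ (g ∘ suc) a b))
  (xor-interchange (x ∧ g zero) (y ∧ g zero) _ _)

⟪⟫-⁅⁆ : (i : Fin n) (g : Fin n → Bool) → ⟪ ⁅ i ⁆ , g ⟫ ≡ g i
⟪⟫-⁅⁆ zero    g = trans (cong (g zero xor_) (⟪⟫-zeroˡ (g ∘ suc))) (𝔹.xor-identityʳ (g zero))
⟪⟫-⁅⁆ (suc i) g = ⟪⟫-⁅⁆ i (g ∘ suc)

-- A bilinear form can be summed by rows or by columns. This is how the columns `b i` of a
-- parity-check matrix are exchanged for its rows.
⟪⟫-swap : (a : 𝔽₂^ n) (c : 𝔽₂^ h) (M : Fin n → Fin h → Bool) →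
  ⟪ a , (λ i → ⟪ c , M i ⟫) ⟫ ≡ ⟪ c , (λ j → ⟪ a , flip M j ⟫) ⟫
⟪⟫-swap a c M = begin
  sum (λ i → lookup a i ∧ sum (λ j → lookup c j ∧ M i j))
    ≡⟨ sum-cong-≗ (λ i → *-distribˡ-sum (lookup a i) (λ j → lookup c j ∧ M i j)) ⟩
  sum (λ i → sum (λ j → lookup a i ∧ (lookup c j ∧ M i j)))
    ≡⟨ ∑-comm (λ i j → lookup a i ∧ (lookup c j ∧ M i j)) ⟩
  sum (λ j → sum (λ i → lookup a i ∧ (lookup c j ∧ M i j)))
    ≡⟨ sum-cong-≗ (λ j → sum-cong-≗ (λ i → ∧-leftComm (lookup a i) (lookup c j) (M i j))) ⟩
  sum (λ j → sum (λ i → lookup c j ∧ (lookup a i ∧ M i j)))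
    ≡⟨ sum-cong-≗ (λ j → *-distribˡ-sum (lookup c j) (λ i → lookup a i ∧ M i j)) ⟨
  sum (λ j → lookup c j ∧ sum (λ i → lookup a i ∧ M i j)) ∎
  where
  open ≡-Reasoning
  open 𝔽₂-Sum

·-⟪⟫ : (a y : 𝔽₂^ n) → a · y ≡ ⟪ a , lookup y ⟫
·-⟪⟫ []      []      = refl
·-⟪⟫ (x ∷ a) (z ∷ y) = cong ((x ∧ z) xor_) (·-⟪⟫ a y)

·-comm : (x y : 𝔽₂^ n) → x · y ≡ y · x
·-comm []      []      = refl
·-comm (a ∷ x) (b ∷ y) = cong₂ _xor_ (𝔹.∧-comm a b) (·-comm x y)

⟪⟫-lookup-⁅⁆ : (a : 𝔽₂^ n) (i : Fin n) → ⟪ a , lookup ⁅ i ⁆ ⟫ ≡ lookup a i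
⟪⟫-lookup-⁅⁆ a i = begin
  ⟪ a , lookup ⁅ i ⁆ ⟫  ≡⟨ ·-⟪⟫ a ⁅ i ⁆ ⟨
  a · ⁅ i ⁆             ≡⟨ ·-comm a ⁅ i ⁆ ⟩
  ⁅ i ⁆ · a             ≡⟨ ·-⟪⟫ ⁅ i ⁆ a ⟩
  ⟪ ⁅ i ⁆ , lookup a ⟫  ≡⟨ ⟪⟫-⁅⁆ i (lookup a) ⟩
  lookup a i            ∎
  where open ≡-Reasoning

-- Throughout, `lookup ⁅ i ⁆ j` serves as the Kronecker delta. Its symmetry comes from pairing two
-- unit vectors and reading off either entry.
lookup-⁅⁆-sym : (i j : Fin n) → lookup ⁅ i ⁆ j ≡ lookup ⁅ j ⁆ i
lookup-⁅⁆-sym i j = trans (sym (⟪⟫-⁅⁆ j (lookup ⁅ i ⁆))) (⟪⟫-lookup-⁅⁆ ⁅ j ⁆ i)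

lookup-⁅⁆-punchIn : (p : Fin (suc n)) (i j : Fin n) →
  lookup ⁅ punchIn p i ⁆ (punchIn p j) ≡ lookup ⁅ i ⁆ j
lookup-⁅⁆-punchIn zero    i       j       = refl
lookup-⁅⁆-punchIn (suc p) zero    zero    = refl
lookup-⁅⁆-punchIn (suc p) zero    (suc j) =
  trans (lookup-replicate (punchIn p j) false) (sym (lookup-replicate j false))
lookup-⁅⁆-punchIn (suc p) (suc i) zero    = refl
lookup-⁅⁆-punchIn (suc p) (suc i) (suc j) = lookup-⁅⁆-punchIn p i j

lookup-⁅i⁆-punchIn : (p : Fin (suc n)) (i : Fin n) → lookup ⁅ p ⁆ (punchIn p i) ≡ false
lookup-⁅i⁆-punchIn zero    i       = lookup-replicate i false
lookup-⁅i⁆-punchIn (suc p) zero    = refl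
lookup-⁅i⁆-punchIn (suc p) (suc i) = lookup-⁅i⁆-punchIn p i

-- The only scalars are 0 and 1, and 𝟎 = 𝟎 ⊕ 𝟎 forces `f 𝟎` to vanish.
additive⇒linear : (f : 𝔽₂^ n → Bool) → (∀ x y → f (x ⊕ y) ≡ f x xor f y) → LinearMap n
additive⇒linear f f-⊕ = mkLinear f f-⊕ f-𝟎 f-*
  where
  f-𝟎 : f 𝟎 ≡ false
  f-𝟎 = trans (cong f (sym (⊕-self 𝟎))) (trans (f-⊕ 𝟎 𝟎) (𝔹.xor-same (f 𝟎)))
  f-* : ∀ a x → f (map (a ∧_) x) ≡ a ∧ f x
  f-* false x = trans (cong f (map-const x false)) f-𝟎
  f-* true  x = cong f (map-id x)

coordinate : Fin n → LinearMap n
coordinate i = additive⇒linear (flip lookup i) (lookup-zipWith _xor_ i)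

functional : (Fin n → Bool) → LinearMap n
functional g = additive⇒linear ⟪_, g ⟫ (⟪⟫-⊕ˡ g)

module _ (φ : LinearMap n) where

  apply-combination : (a : 𝔽₂^ k) (v : Fin k → 𝔽₂^ n) →
    apply φ (linearCombination (space n) a v) ≡ ⟪ a , apply φ ∘ v ⟫
  apply-combination []      v = 0ᴹ-homo φ
  apply-combination (x ∷ a) v = trans (+ᴹ-homo φ _ _)
    (cong₂ _xor_ (*ₗ-homo φ x (v zero)) (apply-combination a (v ∘ suc)))

dual-combination : (a : 𝔽₂^ k) (b : Fin k → LinearMap h) (s : 𝔽₂^ h) →
  apply (linearCombination (dual h) a b) s ≡ ⟪ a , (λ i → apply (b i) s) ⟫
dual-combination []      b s = refl
dual-combination (x ∷ a) b s = cong ((x ∧ apply (b zero) s) xor_) (dual-combination a (b ∘ suc) s)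

combination-⁅⁆ : (x : 𝔽₂^ n) → linearCombination (space n) x ⁅_⁆ ≡ x
combination-⁅⁆ x = lookup-ext λ i → begin
  lookup (linearCombination (space _) x ⁅_⁆) i  ≡⟨ apply-combination (coordinate i) x ⁅_⁆ ⟩
  ⟪ x , (λ j → lookup ⁅ j ⁆ i) ⟫                ≡⟨ ⟪⟫-cong x (λ j → lookup-⁅⁆-sym j i) ⟩
  ⟪ x , lookup ⁅ i ⁆ ⟫                          ≡⟨ ⟪⟫-lookup-⁅⁆ x i ⟩
  lookup x i                                    ∎
  where open ≡-Reasoning

apply-⟪⟫ : (φ : LinearMap n) (x : 𝔽₂^ n) → apply φ x ≡ ⟪ x , apply φ ∘ ⁅_⁆ ⟫
apply-⟪⟫ φ x = trans (cong (apply φ) (sym (combination-⁅⁆ x))) (apply-combination φ x ⁅_⁆)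

-- Complements of a span, by elimination

independent⇒≡𝟎 : (v : Fin k → 𝔽₂^ n) → LinearlyIndependent (space n) v →
  ∀ a → linearCombination (space n) a v ≡ 𝟎 → a ≡ 𝟎
independent⇒≡𝟎 v ind a eq = lookup-ext λ i →
  trans (ind a (λ _ i∉⊤ → contradiction ∈⊤ i∉⊤) eq i) (sym (lookup-replicate i false))

-- A complement of span v with basis vec, together with the coordinates of the projection
-- onto it along span v.
record Complement {n k} (v : Fin k → 𝔽₂^ n) (h : ℕ) : Set where
  field
    vec         : Fin h → 𝔽₂^ n
    coord       : Fin h → LinearMap n
    coord-vec   : ∀ i j → apply (coord i) (vec j) ≡ lookup ⁅ i ⁆ j
    coord-v     : ∀ i j → apply (coord i) (v j) ≡ false
    kernel⊆span : ∀ x → (∀ i → apply (coord i) x ≡ false) →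
                  ∃[ a ] linearCombination (space n) a v ≡ x

  coord-combination : ∀ i a → apply (coord i) (linearCombination (space n) a vec) ≡ lookup a i
  coord-combination i a = trans (apply-combination (coord i) a vec)
    (trans (⟪⟫-cong a (coord-vec i)) (⟪⟫-lookup-⁅⁆ a i))

-- The new vector v zero has a nonzero coordinate p along the complement of the others; it takes
-- the place of vec p, and the functional coord p is eliminated from the other coordinates.
extendComplement : (v : Fin (suc k) → 𝔽₂^ n) (c : Complement (v ∘ suc) (suc h)) (p : Fin (suc h)) →
  apply (Complement.coord c p) (v zero) ≡ true → Complement v h
extendComplement {n = n} {h} v c p p-w = record
  { vec         = vec ∘ punchIn p
  ; coord       = coord′
  ; coord-vec   = λ i j → trans
      (cong₂ _xor_
        (trans (coord-vec (punchIn p i) (punchIn p j)) (lookup-⁅⁆-punchIn p i j))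
        (trans (cong (apply (coord (punchIn p i)) w ∧_)
                 (trans (coord-vec p (punchIn p j)) (lookup-⁅i⁆-punchIn p j)))
               (𝔹.∧-zeroʳ _)))
      (𝔹.xor-identityʳ _)
  ; coord-v     = coord′-v
  ; kernel⊆span = kernel⊆span′
  }
  where
  open Complement c
  open RawLeftModule (dual n)
  w = v zero
  coord′ : Fin h → LinearMap n
  coord′ i = coord (punchIn p i) +ᴹ (apply (coord (punchIn p i)) w *ₗ coord p)
  coord′-v : ∀ i j → apply (coord′ i) (v j) ≡ false
  coord′-v i zero    = trans
    (cong (apply (coord (punchIn p i)) w xor_)
      (trans (cong (apply (coord (punchIn p i)) w ∧_) p-w) (𝔹.∧-identityʳ _)))
    (𝔹.xor-same (apply (coord (punchIn p i)) w))
  coord′-v i (suc j) = cong₂ _xor_ (coord-v (punchIn p i) j)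
    (trans (cong (apply (coord (punchIn p i)) w ∧_) (coord-v p j)) (𝔹.∧-zeroʳ _))
  kernel⊆span′ : ∀ x → (∀ i → apply (coord′ i) x ≡ false) →
                 ∃[ a ] linearCombination (space n) a v ≡ x
  kernel⊆span′ x x∈ker =
    let a , eq = kernel⊆span y y∈ker
    in t ∷ a , trans (cong (tw ⊕_) eq) (⊕-cancelˡ tw x)
    where
    -- The coefficient of `w` is forced by coordinate p, since `coord p` takes the value 1 on `w`.
    -- Adding `tw` clears that coordinate, and turns every other one into the value of the
    -- eliminated functional at x.
    t = apply (coord p) x
    tw = map (t ∧_) w
    y = tw ⊕ x
    coord-y : ∀ i → apply (coord i) y ≡ (t ∧ apply (coord i) w) xor apply (coord i) x
    coord-y i = trans (+ᴹ-homo (coord i) tw x) (cong (_xor apply (coord i) x) (*ₗ-homo (coord i) t w))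
    y∈ker : ∀ i → apply (coord i) y ≡ false
    y∈ker i with p Fin.≟ i
    ... | yes refl = trans (coord-y p)
      (trans (cong (_xor t) (trans (cong (t ∧_) p-w) (𝔹.∧-identityʳ t))) (𝔹.xor-same t))
    ... | no p≢i = subst (λ j → apply (coord j) y ≡ false) (Fin.punchIn-punchOut p≢i)
      (trans (coord-y _)
        (trans (𝔹.xor-comm (t ∧ apply (coord _) w) (apply (coord _) x))
          (trans (cong (apply (coord _) x xor_) (𝔹.∧-comm t (apply (coord _) w)))
                 (x∈ker (punchOut p≢i)))))

-- Steinitz exchange, one vector at a time, starting from the standard basis as complement of the
-- empty span. Each exchange shrinks the complement by one, which keeps h + k = n.
complement : (v : Fin k → 𝔽₂^ n) → LinearlyIndependent (space n) v →
  ∃[ h ] (h ℕ.+ k ≡ n × Complement v h)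
complement {k = zero} {n} v ind = n , ℕ.+-identityʳ n , record
  { vec         = ⁅_⁆
  ; coord       = coordinate
  ; coord-vec   = λ i j → lookup-⁅⁆-sym j i
  ; coord-v     = λ _ ()
  ; kernel⊆span = λ x x∈ker → [] , lookup-ext λ i →
      trans (lookup-replicate i false) (sym (x∈ker i))
  }
complement {k = suc k} {n} v ind with complement (v ∘ suc)
  (λ a _ eq i → trans (cong (λ x → lookup x (suc i)) (independent⇒≡𝟎 v ind (false ∷ a) (tail-eq a eq)))
                      (lookup-replicate i false))
  where
  tail-eq : ∀ a → linearCombination (space n) a (v ∘ suc) ≡ 𝟎 →
    linearCombination (space n) (false ∷ a) v ≡ 𝟎
  tail-eq a eq = trans (cong₂ _⊕_ (map-const (v zero) false) eq) (⊕-self 𝟎)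
... | h , h+k≡n , c = extend h h+k≡n c
  where
  extend : ∀ h → h ℕ.+ k ≡ n → Complement (v ∘ suc) h → ∃[ h ] (h ℕ.+ suc k ≡ n × Complement v h)
  extend h h+k≡n c
    with Fin.any? (λ i → apply (Complement.coord c i) (v zero) 𝔹.≟ true)
  -- All coordinates of `v zero` vanish, so it lies in the span of the others, and the resulting
  -- relation has leading coefficient 1.
  ... | no ∄p =
    let a , eq = Complement.kernel⊆span c (v zero) λ i → 𝔹.¬-not (λ eq → ∄p (i , eq))
        1∷a≡𝟎  = independent⇒≡𝟎 v ind (true ∷ a)
          (trans (cong₂ _⊕_ (map-id (v zero)) eq) (⊕-self (v zero)))
    in contradiction (cong (λ x → lookup x zero) 1∷a≡𝟎) λ ()
  -- For h = 0 there is no p in `Fin zero`, so only a successor can occur.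
  extend (suc h) h+k≡n c | yes (p , p-w) =
    h , trans (ℕ.+-suc h k) h+k≡n , extendComplement v c p p-w

-- Equality and order of Cauchy reals

open +-*-Solver using (solve; _:+_; _:*_; _:-_; :-_; _:=_; con)

infix 4 _≐_

-- Equality of representatives at every index, finer than `_≈ᴿ_`. Rearrangements of finite sums hold
-- in this sense, so tolerances arise only where a hypothesis brings them in.
_≐_ : ℝ → ℝ → Set
x ≐ y = ∀ m → seq x m ≡ seq y m

≐-≈-trans : ∀ x y z → x ≐ y → y ≈ᴿ z → x ≈ᴿ z
≐-≈-trans x y z x≐y y≈z e 0<e = let N , close = y≈z e 0<e in N , λ m m≥N →
  subst (λ p → ℚ.∣ p ℚ.- seq z m ∣ ℚ.≤ e) (sym (x≐y m)) (close m m≥N)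

≐⇒≈ : ∀ x y → x ≐ y → x ≈ᴿ y
≐⇒≈ x y x≐y e 0<e = 0 , λ m _ →
  subst (ℚ._≤ e) (cong ℚ.∣_∣ (sym (trans (cong (ℚ._- seq y m) (x≐y m)) (ℚ.+-inverseʳ (seq y m)))))
    (ℚ.<⇒≤ 0<e)

≈-sym : ∀ x y → x ≈ᴿ y → y ≈ᴿ x
≈-sym x y x≈y e 0<e = let N , close = x≈y e 0<e in N , λ m m≥N →
  subst (ℚ._≤ e)
    (trans (sym (ℚ.∣-p∣≡∣p∣ (seq x m ℚ.- seq y m)))
      (cong ℚ.∣_∣ (solve 2 (λ a b → :- (a :- b) := b :- a) refl (seq x m) (seq y m))))
    (close m m≥N)

≈⇒≤ : ∀ x y → x ≈ᴿ y → x ≤ᴿ y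
≈⇒≤ x y x≈y e 0<e = let N , close = x≈y e 0<e in N , λ m m≥N → begin
  seq x m                               ≡⟨ solve 2 (λ a b → a := b :+ (a :- b)) refl (seq x m) (seq y m) ⟩
  seq y m ℚ.+ (seq x m ℚ.- seq y m)     ≤⟨ ℚ.+-monoʳ-≤ (seq y m) (p≤∣p∣ (seq x m ℚ.- seq y m)) ⟩
  seq y m ℚ.+ ℚ.∣ seq x m ℚ.- seq y m ∣ ≤⟨ ℚ.+-monoʳ-≤ (seq y m) (close m m≥N) ⟩
  seq y m ℚ.+ e                         ∎
  where
  open ℚ.≤-Reasoning
  p≤∣p∣ : ∀ p → p ℚ.≤ ℚ.∣ p ∣
  p≤∣p∣ p with 0ℚ ℚ.≤? p
  ... | yes 0≤p = ℚ.≤-reflexive (sym (ℚ.0≤p⇒∣p∣≡p 0≤p))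
  ... | no  0≰p = ℚ.≤-trans (ℚ.<⇒≤ (ℚ.≰⇒> 0≰p)) (ℚ.0≤∣p∣ p)

≐⇒≤ : ∀ x y → x ≐ y → x ≤ᴿ y
≐⇒≤ x y x≐y = ≈⇒≤ x y (≐⇒≈ x y x≐y)

½-pos : ∀ {e} → 0ℚ ℚ.< e → 0ℚ ℚ.< ½ ℚ.* e
½-pos = ℚ.*-monoʳ-<-pos ½

≤ᴿ-trans : ∀ x y z → x ≤ᴿ y → y ≤ᴿ z → x ≤ᴿ z
≤ᴿ-trans x y z x≤y y≤z e 0<e =
  let M , x≤y+ = x≤y (½ ℚ.* e) (½-pos 0<e)
      N , y≤z+ = y≤z (½ ℚ.* e) (½-pos 0<e)
  in M ⊔ N , λ m m≥ → begin
    seq x m                              ≤⟨ x≤y+ m (ℕ.m⊔n≤o⇒m≤o M N m≥) ⟩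
    seq y m ℚ.+ ½ ℚ.* e                  ≤⟨ ℚ.+-monoˡ-≤ (½ ℚ.* e) (y≤z+ m (ℕ.m⊔n≤o⇒n≤o M N m≥)) ⟩
    seq z m ℚ.+ ½ ℚ.* e ℚ.+ ½ ℚ.* e
      ≡⟨ solve 2 (λ z e → z :+ con ½ :* e :+ con ½ :* e := z :+ e) refl (seq z m) e ⟩
    seq z m ℚ.+ e                        ∎
  where open ℚ.≤-Reasoning

+ᴿ-mono-≤ : ∀ x y z w → x ≤ᴿ y → z ≤ᴿ w → x +ᴿ z ≤ᴿ y +ᴿ w
+ᴿ-mono-≤ x y z w x≤y z≤w e 0<e =
  let M , x≤y+ = x≤y (½ ℚ.* e) (½-pos 0<e)
      N , z≤w+ = z≤w (½ ℚ.* e) (½-pos 0<e)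
  in M ⊔ N , λ m m≥ → begin
    seq x m ℚ.+ seq z m
      ≤⟨ ℚ.+-mono-≤ (x≤y+ m (ℕ.m⊔n≤o⇒m≤o M N m≥)) (z≤w+ m (ℕ.m⊔n≤o⇒n≤o M N m≥)) ⟩
    (seq y m ℚ.+ ½ ℚ.* e) ℚ.+ (seq w m ℚ.+ ½ ℚ.* e)
      ≡⟨ solve 3 (λ y w e → (y :+ con ½ :* e) :+ (w :+ con ½ :* e) := (y :+ w) :+ e)
           refl (seq y m) (seq w m) e ⟩
    (seq y m ℚ.+ seq w m) ℚ.+ e ∎
  where open ℚ.≤-Reasoning

-- Reduces a linear rearrangement of an inequality to one rational identity per index, fit for the
-- ring solver. A tolerance e for z ≤ w is met by using e / c for x ≤ y.
≤ᴿ-rescale : ∀ c .{{_ : ℚ.Positive c}} x y z w →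
  (∀ m → seq w m ℚ.- seq z m ≡ c ℚ.* (seq y m ℚ.- seq x m)) → x ≤ᴿ y → z ≤ᴿ w
≤ᴿ-rescale c x y z w w-z≡ x≤y e 0<e =
  let N , x≤y+ = x≤y (c⁻¹ ℚ.* e) 0<c⁻¹e
  in N , λ m m≥N → begin
    seq z m
      ≡⟨ solve 2 (λ z w → z := w :+ :- (w :- z)) refl (seq z m) (seq w m) ⟩
    seq w m ℚ.+ (ℚ.- (seq w m ℚ.- seq z m))
      ≡⟨ cong (λ t → seq w m ℚ.+ (ℚ.- t)) (w-z≡ m) ⟩
    seq w m ℚ.+ (ℚ.- (c ℚ.* (seq y m ℚ.- seq x m)))
      ≡⟨ solve 4 (λ w c x y → w :+ :- (c :* (y :- x)) := w :+ (c :* x :- c :* y))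
           refl (seq w m) c (seq x m) (seq y m) ⟩
    seq w m ℚ.+ (c ℚ.* seq x m ℚ.- c ℚ.* seq y m)
      ≤⟨ ℚ.+-monoʳ-≤ (seq w m) (ℚ.+-monoˡ-≤ (ℚ.- (c ℚ.* seq y m))
           (ℚ.*-monoˡ-≤-nonNeg c {{ℚ.pos⇒nonNeg c}} (x≤y+ m m≥N))) ⟩
    seq w m ℚ.+ (c ℚ.* (seq y m ℚ.+ c⁻¹ ℚ.* e) ℚ.- c ℚ.* seq y m)
      ≡⟨ solve 5 (λ w c y d e → w :+ (c :* (y :+ d :* e) :- c :* y) := w :+ (c :* d) :* e)
           refl (seq w m) c (seq y m) c⁻¹ e ⟩
    seq w m ℚ.+ (c ℚ.* c⁻¹) ℚ.* e
      ≡⟨ cong (λ t → seq w m ℚ.+ t ℚ.* e) (ℚ.*-inverseʳ c {{c≢0}}) ⟩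
    seq w m ℚ.+ 1ℚ ℚ.* e
      ≡⟨ cong (seq w m ℚ.+_) (ℚ.*-identityˡ e) ⟩
    seq w m ℚ.+ e ∎
  where
  open ℚ.≤-Reasoning
  c≢0 : ℚ.NonZero c
  c≢0 = ℚ.pos⇒nonZero c
  c⁻¹ : ℚ
  c⁻¹ = (ℚ.1/ c) {{c≢0}}
  0<c⁻¹e : 0ℚ ℚ.< c⁻¹ ℚ.* e
  0<c⁻¹e = subst (ℚ._< c⁻¹ ℚ.* e) (ℚ.*-zeroʳ c⁻¹)
    (ℚ.*-monoʳ-<-pos c⁻¹ {{ℚ.1/pos⇒pos c}} 0<e)

-- Sums over the cube and pushforward of distributions

∑-mono-≤ : {f g : 𝔽₂^ n → ℝ} → (∀ x → f x ≤ᴿ g x) → ∑ f ≤ᴿ ∑ g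
∑-mono-≤ {zero}          f≤g = f≤g []
∑-mono-≤ {suc n} {f} {g} f≤g =
  +ᴿ-mono-≤ (∑ (f ∘ (false ∷_))) (∑ (g ∘ (false ∷_))) (∑ (f ∘ (true ∷_))) (∑ (g ∘ (true ∷_)))
    (∑-mono-≤ (f≤g ∘ (false ∷_))) (∑-mono-≤ (f≤g ∘ (true ∷_)))

∑-cong : {f g : 𝔽₂^ n → ℝ} → (∀ x → f x ≐ g x) → ∑ f ≐ ∑ g
∑-cong {zero}  f≐g   = f≐g []
∑-cong {suc n} f≐g m =
  cong₂ ℚ._+_ (∑-cong (f≐g ∘ (false ∷_)) m) (∑-cong (f≐g ∘ (true ∷_)) m)

∑-zero : ∀ n → ∑ {n} (λ _ → 0ᴿ) ≐ 0ᴿ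
∑-zero zero    m = refl
∑-zero (suc n) m = cong₂ ℚ._+_ (∑-zero n m) (∑-zero n m)

∑-+ : (f g : 𝔽₂^ n → ℝ) → ∑ (λ x → f x +ᴿ g x) ≐ ∑ f +ᴿ ∑ g
∑-+ {zero}  f g m = refl
∑-+ {suc n} f g m = trans
  (cong₂ ℚ._+_ (∑-+ (f ∘ (false ∷_)) (g ∘ (false ∷_)) m) (∑-+ (f ∘ (true ∷_)) (g ∘ (true ∷_)) m))
  (solve 4 (λ a b c d → (a :+ b) :+ (c :+ d) := (a :+ c) :+ (b :+ d)) refl
    (seq (∑ (f ∘ (false ∷_))) m) (seq (∑ (g ∘ (false ∷_))) m)
    (seq (∑ (f ∘ (true ∷_))) m) (seq (∑ (g ∘ (true ∷_))) m))

∑-swap : (F : 𝔽₂^ n → 𝔽₂^ h → ℝ) → ∑ (λ x → ∑ (F x)) ≐ ∑ (λ y → ∑ (λ x → F x y))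
∑-swap {zero}  F m = refl
∑-swap {suc n} F m = trans
  (cong₂ ℚ._+_ (∑-swap (F ∘ (false ∷_)) m) (∑-swap (F ∘ (true ∷_)) m))
  (sym (∑-+ (λ y → ∑ (λ x → F (false ∷ x) y)) (λ y → ∑ (λ x → F (true ∷ x) y)) m))

∑-if : (P : Bool) (f : 𝔽₂^ n → ℝ) →
  (if P then ∑ f else 0ᴿ) ≐ ∑ (λ x → if P then f x else 0ᴿ)
∑-if true  f m = refl
∑-if {n} false f m = sym (∑-zero n m)

infix 4 _≟_

_≟_ : DecidableEquality (𝔽₂^ n)
_≟_ = ≡-dec 𝔹._≟_

∑-δ : (z : 𝔽₂^ n) (g : 𝔽₂^ n → ℝ) → ∑ (λ y → if does (z ≟ y) then g y else 0ᴿ) ≐ g z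
∑-δ []          g m = refl
∑-δ {suc n} (false ∷ z) g m = trans
  (cong₂ ℚ._+_ (∑-δ z (g ∘ (false ∷_)) m) (∑-zero n m))
  (ℚ.+-identityʳ _)
∑-δ {suc n} (true ∷ z)  g m = trans
  (cong₂ ℚ._+_ (∑-zero n m) (∑-δ z (g ∘ (true ∷_)) m))
  (ℚ.+-identityˡ _)

-- The events may differ on null outcomes. With the hypothesis in this form, a disagreement refutes
-- α ∈ C^⊥, which is exactly what `supported` asks for.
Pr-mono-≤ : (D : Distribution n) (P Q : 𝔽₂^ n → Bool) →
  (∀ x → P x ≢ Q x → prob D x ≈ᴿ 0ᴿ) → Pr D P ≤ᴿ Pr D Q
Pr-mono-≤ D P Q null = ∑-mono-≤ term
  where
  term : ∀ x → (if P x then prob D x else 0ᴿ) ≤ᴿ (if Q x then prob D x else 0ᴿ)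
  term x with P x | Q x | null x
  ... | true  | true  | _  = ≐⇒≤ (prob D x) (prob D x) (λ _ → refl)
  ... | false | false | _  = ≐⇒≤ 0ᴿ 0ᴿ (λ _ → refl)
  ... | true  | false | nx = ≈⇒≤ (prob D x) 0ᴿ (nx λ ())
  ... | false | true  | nx = ≈⇒≤ 0ᴿ (prob D x) (≈-sym (prob D x) 0ᴿ (nx λ ()))

module Pushforward (ρ : 𝔽₂^ n → 𝔽₂^ h) (D : Distribution n) where

  pushProb : 𝔽₂^ h → ℝ
  pushProb y = ∑ λ x → if does (ρ x ≟ y) then prob D x else 0ᴿ

  -- After the two sums are exchanged, the inner one over y sees a point mass at `ρ x`. The constant
  -- event gives the total mass.
  ∑-push : (P : 𝔽₂^ h → Bool) →
    ∑ (λ y → if P y then pushProb y else 0ᴿ) ≐ Pr D (P ∘ ρ)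
  ∑-push P m = trans
    (∑-cong {g = λ y → ∑ λ x → if P y then (if does (ρ x ≟ y) then prob D x else 0ᴿ) else 0ᴿ}
      (λ y → ∑-if (P y) (λ x → if does (ρ x ≟ y) then prob D x else 0ᴿ)) m)
    (trans (∑-swap (λ y x → if P y then (if does (ρ x ≟ y) then prob D x else 0ᴿ) else 0ᴿ) m)
      (∑-cong (λ x m → trans
        (∑-cong {g = λ y → if does (ρ x ≟ y) then (if P y then prob D x else 0ᴿ) else 0ᴿ}
          (λ y m → cong (λ t → seq t m) (𝔹.if-swap-then (P y) (does (ρ x ≟ y)))) m)
        (∑-δ (ρ x) (λ y → if P y then prob D x else 0ᴿ) m)) m))

  pushforward : Distribution h
  pushforward = record
    { prob   = pushProb
    ; nonNeg = λ y → ≤ᴿ-trans 0ᴿ (∑ {n} (λ _ → 0ᴿ)) (pushProb y)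
        (≐⇒≤ 0ᴿ (∑ {n} (λ _ → 0ᴿ)) (λ m → sym (∑-zero n m)))
        (∑-mono-≤ λ x → term-nonNeg (does (ρ x ≟ y)) x)
    ; total  = ≐-≈-trans (∑ pushProb) (∑ (prob D)) 1ᴿ (∑-push (λ _ → true)) (total D)
    }
    where
    term-nonNeg : ∀ b x → 0ᴿ ≤ᴿ (if b then prob D x else 0ᴿ)
    term-nonNeg true  x = nonNeg D x
    term-nonNeg false x = ≐⇒≤ 0ᴿ 0ᴿ (λ _ → refl)

  pushProb-off-image : ∀ y → (∀ x → ρ x ≢ y) → pushProb y ≈ᴿ 0ᴿ
  pushProb-off-image y y∉ = ≐⇒≈ (pushProb y) 0ᴿ (λ m →
    trans (∑-cong {g = λ _ → 0ᴿ} term-zero m) (∑-zero n m))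
    where
    term-zero : ∀ x → (if does (ρ x ≟ y) then prob D x else 0ᴿ) ≐ 0ᴿ
    term-zero x m with ρ x ≟ y
    ... | yes eq = contradiction eq (y∉ x)
    ... | no  _  = refl

  Pr-pushforward-≤ : (P : 𝔽₂^ h → Bool) (Q : 𝔽₂^ n → Bool) →
    (∀ x → P (ρ x) ≢ Q x → prob D x ≈ᴿ 0ᴿ) → Pr pushforward P ≤ᴿ Pr D Q
  Pr-pushforward-≤ P Q null = ≤ᴿ-trans (Pr pushforward P) (Pr D (P ∘ ρ)) (Pr D Q)
    (≐⇒≤ (Pr pushforward P) (Pr D (P ∘ ρ)) (∑-push P)) (Pr-mono-≤ D (P ∘ ρ) Q null)

  Pr-pushforward-≥ : (P : 𝔽₂^ h → Bool) (Q : 𝔽₂^ n → Bool) →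
    (∀ x → Q x ≢ P (ρ x) → prob D x ≈ᴿ 0ᴿ) → Pr D Q ≤ᴿ Pr pushforward P
  Pr-pushforward-≥ P Q null = ≤ᴿ-trans (Pr D Q) (Pr D (P ∘ ρ)) (Pr pushforward P)
    (Pr-mono-≤ D Q (P ∘ ρ) null) (≐⇒≤ (Pr D (P ∘ ρ)) (Pr pushforward P) (sym ∘ ∑-push P))

-- Eigenvalues as probabilities

2ℚ : ℚ
2ℚ = + 2 ℚ./ 1

∑-affine : (p q : 𝔽₂^ n → ℝ) → ∑ (λ x → p x -ᴿ 2ᴿ *ᴿ q x) ≐ ∑ p -ᴿ 2ᴿ *ᴿ ∑ q
∑-affine {zero}  p q m = refl
∑-affine {suc n} p q m = trans
  (cong₂ ℚ._+_ (∑-affine (p ∘ (false ∷_)) (q ∘ (false ∷_)) m)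
               (∑-affine (p ∘ (true ∷_)) (q ∘ (true ∷_)) m))
  (regroup (seq (∑ (p ∘ (false ∷_))) m) (seq (∑ (q ∘ (false ∷_))) m)
           (seq (∑ (p ∘ (true ∷_))) m) (seq (∑ (q ∘ (true ∷_))) m))
  where
  regroup : ∀ a b c d → (a ℚ.- 2ℚ ℚ.* b) ℚ.+ (c ℚ.- 2ℚ ℚ.* d) ≡ (a ℚ.+ c) ℚ.- 2ℚ ℚ.* (b ℚ.+ d)
  regroup = solve 4 (λ a b c d → (a :- con 2ℚ :* b) :+ (c :- con 2ℚ :* d)
                              := (a :+ c) :- con 2ℚ :* (b :+ d)) refl

-- A character is 1 - 2 times the indicator of f = 1. The total mass stays as a sum here because it
-- equals 1 only up to `_≈ᴿ_`, not index by index.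
eigenvalue≐ : (𝒢 : CayleyGraph h) (f : LinearMap h) →
  eigenvalue 𝒢 f ≐ ∑ (prob (𝒟 𝒢)) -ᴿ 2ᴿ *ᴿ Pr (𝒟 𝒢) (apply f)
eigenvalue≐ 𝒢 f m = trans
  (∑-cong {f = λ x → prob (𝒟 𝒢) x *ᴿ χ f x}
          {g = λ x → prob (𝒟 𝒢) x -ᴿ 2ᴿ *ᴿ (if apply f x then prob (𝒟 𝒢) x else 0ᴿ)}
    (λ x m → sign-case m (apply f x) (prob (𝒟 𝒢) x)) m)
  (∑-affine (prob (𝒟 𝒢)) (λ x → if apply f x then prob (𝒟 𝒢) x else 0ᴿ) m)
  where
  negate : ∀ a → a ℚ.* (ℚ.- 1ℚ) ≡ a ℚ.- 2ℚ ℚ.* a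
  negate = solve 1 (λ a → a :* :- con 1ℚ := a :- con 2ℚ :* a) refl
  keep : ∀ a → a ℚ.* 1ℚ ≡ a ℚ.- 2ℚ ℚ.* 0ℚ
  keep = solve 1 (λ a → a :* con 1ℚ := a :- con 2ℚ :* con 0ℚ) refl
  sign-case : ∀ m b x →
    seq x m ℚ.* seq (if b then -ᴿ 1ᴿ else 1ᴿ) m ≡ seq x m ℚ.- 2ℚ ℚ.* seq (if b then x else 0ᴿ) m
  sign-case m true  x = negate (seq x m)
  sign-case m false x = keep (seq x m)

module _ (T π Λ : ℝ) (T≈1 : T ≈ᴿ 1ᴿ) (Λ≐ : Λ ≐ T -ᴿ 2ᴿ *ᴿ π) where
  private
    T≤1 : T ≤ᴿ 1ᴿ
    T≤1 = ≈⇒≤ T 1ᴿ T≈1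

    1≤T : 1ᴿ ≤ᴿ T
    1≤T = ≈⇒≤ 1ᴿ T (≈-sym T 1ᴿ T≈1)

    Λ′ : ℝ
    Λ′ = T -ᴿ 2ᴿ *ᴿ π

    Λ≤Λ′ : Λ ≤ᴿ Λ′
    Λ≤Λ′ = ≐⇒≤ Λ Λ′ Λ≐

    Λ′≤Λ : Λ′ ≤ᴿ Λ
    Λ′≤Λ = ≐⇒≤ Λ′ Λ (sym ∘ Λ≐)

  -- The mass T and 1 are placed on opposite sides of the inequality before rescaling, so that the
  -- remaining identity is exact; the factors 1 and ½ account for doubling and halving.
  ≤⇔1-2*≥ : ∀ ε → (π ≤ᴿ ε) ⇔ (1ᴿ -ᴿ 2ᴿ *ᴿ ε ≤ᴿ Λ)
  ≤⇔1-2*≥ ε = mk⇔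
    (λ π≤ε → ≤ᴿ-trans (1ᴿ -ᴿ 2ᴿ *ᴿ ε) Λ′ Λ
      (≤ᴿ-rescale 1ℚ (π +ᴿ π +ᴿ 1ᴿ) (ε +ᴿ ε +ᴿ T) (1ᴿ -ᴿ 2ᴿ *ᴿ ε) Λ′
        (λ m → double (seq T m) (seq π m) (seq ε m))
        (+ᴿ-mono-≤ (π +ᴿ π) (ε +ᴿ ε) 1ᴿ T (+ᴿ-mono-≤ π ε π ε π≤ε π≤ε) 1≤T))
      Λ′≤Λ)
    (λ ≤Λ → ≤ᴿ-rescale ½ (1ᴿ -ᴿ 2ᴿ *ᴿ ε +ᴿ T) (Λ′ +ᴿ 1ᴿ) π ε
      (λ m → halve (seq T m) (seq π m) (seq ε m))
      (+ᴿ-mono-≤ (1ᴿ -ᴿ 2ᴿ *ᴿ ε) Λ′ T 1ᴿ (≤ᴿ-trans (1ᴿ -ᴿ 2ᴿ *ᴿ ε) Λ Λ′ ≤Λ Λ≤Λ′) T≤1))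
    where
    double : ∀ t p e → (t ℚ.- 2ℚ ℚ.* p) ℚ.- (1ℚ ℚ.- 2ℚ ℚ.* e)
                     ≡ 1ℚ ℚ.* ((e ℚ.+ e ℚ.+ t) ℚ.- (p ℚ.+ p ℚ.+ 1ℚ))
    double = solve 3 (λ t p e → (t :- con 2ℚ :* p) :- (con 1ℚ :- con 2ℚ :* e)
                             := con 1ℚ :* ((e :+ e :+ t) :- (p :+ p :+ con 1ℚ))) refl
    halve : ∀ t p e → e ℚ.- p
                    ≡ ½ ℚ.* (((t ℚ.- 2ℚ ℚ.* p) ℚ.+ 1ℚ) ℚ.- ((1ℚ ℚ.- 2ℚ ℚ.* e) ℚ.+ t))
    halve = solve 3 (λ t p e → e :- p
      := con ½ :* (((t :- con 2ℚ :* p) :+ con 1ℚ) :- ((con 1ℚ :- con 2ℚ :* e) :+ t))) refl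

  ≥⇔1-2*≤ : ∀ δ r → (δ *ᴿ r ≤ᴿ π) ⇔ (Λ ≤ᴿ 1ᴿ -ᴿ 2ᴿ *ᴿ δ *ᴿ r)
  ≥⇔1-2*≤ δ r = mk⇔
    (λ x≤π → ≤ᴿ-trans Λ Λ′ (1ᴿ -ᴿ 2ᴿ *ᴿ δ *ᴿ r) Λ≤Λ′
      (≤ᴿ-rescale 1ℚ (x +ᴿ x +ᴿ T) (π +ᴿ π +ᴿ 1ᴿ) Λ′ (1ᴿ -ᴿ 2ᴿ *ᴿ δ *ᴿ r)
        (λ m → double (seq T m) (seq π m) (seq δ m) (seq r m))
        (+ᴿ-mono-≤ (x +ᴿ x) (π +ᴿ π) T 1ᴿ (+ᴿ-mono-≤ x π x π x≤π x≤π) T≤1)))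
    (λ Λ≤ → ≤ᴿ-rescale ½ (Λ′ +ᴿ 1ᴿ) (1ᴿ -ᴿ 2ᴿ *ᴿ δ *ᴿ r +ᴿ T) x π
      (λ m → halve (seq T m) (seq π m) (seq δ m) (seq r m))
      (+ᴿ-mono-≤ Λ′ (1ᴿ -ᴿ 2ᴿ *ᴿ δ *ᴿ r) 1ᴿ T (≤ᴿ-trans Λ′ Λ (1ᴿ -ᴿ 2ᴿ *ᴿ δ *ᴿ r) Λ′≤Λ Λ≤) 1≤T))
    where
    x : ℝ
    x = δ *ᴿ r
    double : ∀ t p d r → (1ℚ ℚ.- 2ℚ ℚ.* d ℚ.* r) ℚ.- (t ℚ.- 2ℚ ℚ.* p)
                       ≡ 1ℚ ℚ.* ((p ℚ.+ p ℚ.+ 1ℚ) ℚ.- (d ℚ.* r ℚ.+ d ℚ.* r ℚ.+ t))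
    double = solve 4 (λ t p d r → (con 1ℚ :- con 2ℚ :* d :* r) :- (t :- con 2ℚ :* p)
                               := con 1ℚ :* ((p :+ p :+ con 1ℚ) :- (d :* r :+ d :* r :+ t))) refl
    halve : ∀ t p d r → p ℚ.- d ℚ.* r
                      ≡ ½ ℚ.* (((1ℚ ℚ.- 2ℚ ℚ.* d ℚ.* r) ℚ.+ t) ℚ.- ((t ℚ.- 2ℚ ℚ.* p) ℚ.+ 1ℚ))
    halve = solve 4 (λ t p d r → p :- d :* r
      := con ½ :* (((con 1ℚ :- con 2ℚ :* d :* r) :+ t) :- ((t :- con 2ℚ :* p) :+ con 1ℚ))) refl

module _ (𝒢 : CayleyGraph h) (f : LinearMap h) where

  Pr≤⇔≤eigenvalue : ∀ ε → (Pr (𝒟 𝒢) (apply f) ≤ᴿ ε) ⇔ (1ᴿ -ᴿ 2ᴿ *ᴿ ε ≤ᴿ eigenvalue 𝒢 f)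
  Pr≤⇔≤eigenvalue = ≤⇔1-2*≥ (∑ (prob (𝒟 𝒢))) (Pr (𝒟 𝒢) (apply f)) (eigenvalue 𝒢 f)
    (total (𝒟 𝒢)) (eigenvalue≐ 𝒢 f)

  ≤Pr⇔eigenvalue≤ : ∀ δ r →
    (δ *ᴿ r ≤ᴿ Pr (𝒟 𝒢) (apply f)) ⇔ (eigenvalue 𝒢 f ≤ᴿ 1ᴿ -ᴿ 2ᴿ *ᴿ δ *ᴿ r)
  ≤Pr⇔eigenvalue≤ = ≥⇔1-2*≤ (∑ (prob (𝒟 𝒢))) (Pr (𝒟 𝒢) (apply f)) (eigenvalue 𝒢 f)
    (total (𝒟 𝒢)) (eigenvalue≐ 𝒢 f)

-- Dimension of a kernel

combination∈ : {P : Pred (𝔽₂^ n) 0ℓ} → IsSubspace (space n) P → {v : Fin k → 𝔽₂^ n} →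
  (∀ i → v i ∈ P) → ∀ a → linearCombination (space n) a v ∈ P
combination∈ isSub v∈P []      = IsSubspace.0∈ isSub
combination∈ isSub v∈P (x ∷ a) =
  IsSubspace.+∈ isSub (IsSubspace.*∈ isSub x (v∈P zero)) (combination∈ isSub (v∈P ∘ suc) a)

Kernel : (Fin h → LinearMap n) → Pred (𝔽₂^ n) 0ℓ
Kernel σ x = ∀ j → apply (σ j) x ≡ false

Kernel-isSubspace : (σ : Fin h → LinearMap n) → IsSubspace (space n) (Kernel σ)
Kernel-isSubspace σ = record
  { 0∈ = λ j → 0ᴹ-homo (σ j)
  ; +∈ = λ x∈ y∈ j → trans (+ᴹ-homo (σ j) _ _) (cong₂ _xor_ (x∈ j) (y∈ j))
  ; *∈ = λ a x∈ j → trans (*ₗ-homo (σ j) a _) (trans (cong (a ∧_) (x∈ j)) (𝔹.∧-zeroʳ a))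
  }

-- A basis of the kernel is obtained by projecting a complement of span u into it along span u.
kernel-dimension : (σ : Fin h → LinearMap n) (u : Fin h → 𝔽₂^ n) →
  (∀ i j → apply (σ i) (u j) ≡ lookup ⁅ i ⁆ j) →
  ∃[ k ] (k ℕ.+ h ≡ n × HasDimension (space n) (Kernel σ) k)
kernel-dimension {h} {n} σ u σ-u =
  let k , k+h≡n , c = complement u u-independent
  in k , k+h≡n , basis c , basis∈ c , basis-independent c , basis-spans c
  where
  open ≡-Reasoning
  σ-combination : ∀ i a → apply (σ i) (linearCombination (space n) a u) ≡ lookup a i
  σ-combination i a = trans (apply-combination (σ i) a u)
    (trans (⟪⟫-cong a (σ-u i)) (⟪⟫-lookup-⁅⁆ a i))

  u-independent : LinearlyIndependent (space n) u
  u-independent a _ eq i = begin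
    lookup a i                                     ≡⟨ σ-combination i a ⟨
    apply (σ i) (linearCombination (space n) a u)  ≡⟨ cong (apply (σ i)) eq ⟩
    apply (σ i) 𝟎                                  ≡⟨ 0ᴹ-homo (σ i) ⟩
    false                                          ∎

  σ-values : 𝔽₂^ n → 𝔽₂^ h
  σ-values x = tabulate (λ j → apply (σ j) x)

  projection : 𝔽₂^ n → 𝔽₂^ n
  projection x = linearCombination (space n) (σ-values x) u

  module _ {k} (c : Complement u k) where
    open Complement c

    basis : Fin k → 𝔽₂^ n
    basis i = vec i ⊕ projection (vec i)

    basis∈ : ∀ i → basis i ∈ Kernel σ
    basis∈ i j = begin
      apply (σ j) (vec i ⊕ projection (vec i))
        ≡⟨ +ᴹ-homo (σ j) (vec i) (projection (vec i)) ⟩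
      apply (σ j) (vec i) xor apply (σ j) (projection (vec i))
        ≡⟨ cong (apply (σ j) (vec i) xor_)
             (trans (σ-combination j (σ-values (vec i))) (lookup∘tabulate (λ j → apply (σ j) (vec i)) j)) ⟩
      apply (σ j) (vec i) xor apply (σ j) (vec i)
        ≡⟨ 𝔹.xor-same (apply (σ j) (vec i)) ⟩
      false ∎

    -- The correction from `vec` to `basis` lies in span `u`, where `coord` vanishes, so coordinates
    -- are unchanged.
    coord-basis : ∀ i a → apply (coord i) (linearCombination (space n) a basis) ≡ lookup a i
    coord-basis i a = begin
      apply (coord i) (linearCombination (space n) a basis)
        ≡⟨ apply-combination (coord i) a basis ⟩
      ⟪ a , apply (coord i) ∘ basis ⟫
        ≡⟨ ⟪⟫-cong a (λ j → trans (+ᴹ-homo (coord i) (vec j) (projection (vec j)))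
             (cong₂ _xor_ (coord-vec i j)
               (trans (apply-combination (coord i) (σ-values (vec j)) u)
                 (⟪⟫-zeroʳ (σ-values (vec j)) (coord-v i))))) ⟩
      ⟪ a , (λ j → lookup ⁅ i ⁆ j xor false) ⟫
        ≡⟨ ⟪⟫-cong a (λ j → 𝔹.xor-identityʳ _) ⟩
      ⟪ a , lookup ⁅ i ⁆ ⟫
        ≡⟨ ⟪⟫-lookup-⁅⁆ a i ⟩
      lookup a i ∎

    basis-independent : LinearlyIndependent (space n) basis
    basis-independent a _ eq i = begin
      lookup a i                                             ≡⟨ coord-basis i a ⟨
      apply (coord i) (linearCombination (space n) a basis)  ≡⟨ cong (apply (coord i)) eq ⟩
      apply (coord i) 𝟎                                      ≡⟨ 0ᴹ-homo (coord i) ⟩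
      false                                                  ∎

    basis-spans : Spans (space n) basis (Kernel σ)
    basis-spans x x∈ker = a , sym (x⊕y≡𝟎⇒x≡y x z y≡𝟎)
      where
      a = tabulate (λ i → apply (coord i) x)
      z = linearCombination (space n) a basis
      coord-y : ∀ i → apply (coord i) (x ⊕ z) ≡ false
      coord-y i = begin
        apply (coord i) (x ⊕ z)                ≡⟨ +ᴹ-homo (coord i) x z ⟩
        apply (coord i) x xor apply (coord i) z
          ≡⟨ cong (apply (coord i) x xor_)
               (trans (coord-basis i a) (lookup∘tabulate (λ i → apply (coord i) x) i)) ⟩
        apply (coord i) x xor apply (coord i) x ≡⟨ 𝔹.xor-same (apply (coord i) x) ⟩
        false                                  ∎
      y∈ker : (x ⊕ z) ∈ Kernel σ
      y∈ker = IsSubspace.+∈ (Kernel-isSubspace σ) x∈ker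
        (combination∈ (Kernel-isSubspace σ) basis∈ a)
      -- The kernel meets span `u` only in 𝟎: with all coordinates zero, x ⊕ z is a combination of
      -- `u`, and the functionals σ read off its coefficients.
      y≡𝟎 : x ⊕ z ≡ 𝟎
      y≡𝟎 with kernel⊆span (x ⊕ z) coord-y
      ... | e , eq = trans (sym eq) (trans (cong (λ e → linearCombination (space n) e u) e≡𝟎)
              𝟎u≡𝟎)
        where
        e≡𝟎 : e ≡ 𝟎
        e≡𝟎 = lookup-ext λ j → begin
          lookup e j                                     ≡⟨ σ-combination j e ⟨
          apply (σ j) (linearCombination (space n) e u)  ≡⟨ cong (apply (σ j)) eq ⟩
          apply (σ j) (x ⊕ z)                            ≡⟨ y∈ker j ⟩
          false                                          ≡⟨ lookup-replicate j false ⟨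
          lookup 𝟎 j                                     ∎
        𝟎u≡𝟎 : linearCombination (space n) 𝟎 u ≡ 𝟎
        𝟎u≡𝟎 = lookup-ext λ i → begin
          lookup (linearCombination (space n) 𝟎 u) i ≡⟨ apply-combination (coordinate i) 𝟎 u ⟩
          ⟪ 𝟎 , (λ j → lookup (u j) i) ⟫             ≡⟨ ⟪⟫-zeroˡ (λ j → lookup (u j) i) ⟩
          false                                      ≡⟨ lookup-replicate i false ⟨
          lookup 𝟎 i                                 ∎

-- Parity checks: distance, independence and rank

IsMin-cong : {P Q : Pred ℕ 0ℓ} → (∀ j → P j ⇔ Q j) → ∀ m → IsMin P m → IsMin Q m
IsMin-cong P⇔Q m (m∈P , least) = to (P⇔Q m) m∈P , λ j j∈Q → least j (from (P⇔Q j) j∈Q)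

-- The classical syndrome vector has as j-th bit the value at `⁅ j ⁆`; here it is kept as a
-- functional of s.
syndrome : (Fin n → LinearMap h) → 𝔽₂^ n → 𝔽₂^ h → Bool
syndrome b x s = ⟪ x , (λ i → apply (b i) s) ⟫

-- The columns of a parity-check matrix of C are the coefficient vectors of the functionals b i.
IsParityCheck : (Fin n → LinearMap h) → Code n → Set
IsParityCheck b C = ∀ x → x ∈ Codeword C ⇔ (∀ s → syndrome b x s ≡ false)

module ParityCheck (C : Code n) (b : Fin n → LinearMap h) (isParityCheck : IsParityCheck b C) where

  -- A relation among the members indexed by T is a codeword supported on T, hence of weight below
  -- d. It is zero because equality of vectors is decidable, so refuting `a ≢ 𝟎` suffices.
  wiseIndependent : ∀ {d} → HasDistance C d → WiseIndependent (dual h) d b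
  wiseIndependent dist T ∣T∣<d a a⊆T ab≈0 i =
    trans (cong (flip lookup i) (decidable-stable (a ≟ 𝟎) a≢𝟎⇒⊥)) (lookup-replicate i false)
    where
    a∈C : a ∈ Codeword C
    a∈C = from (isParityCheck a) λ s → trans (sym (dual-combination a b s)) (ab≈0 s)
    supp : a ⊆ T
    supp {j} j∈a = decidable-stable (j ∈? T) λ j∉T →
      contradiction (trans (sym ([]=⇒lookup j∈a)) (a⊆T j j∉T)) λ ()
    a≢𝟎⇒⊥ : ¬ (a ≢ 𝟎)
    a≢𝟎⇒⊥ a≢𝟎 = ℕ.<⇒≱ ∣T∣<d (ℕ.≤-trans (dist a a∈C a≢𝟎) (p⊆q⇒∣p∣≤∣q∣ supp))

  -- A codeword c is a relation on the subfamily indexed by its own support, so independence is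
  -- applied with T = c.
  hasDistance : ∀ {d} → WiseIndependent (dual h) d b → HasDistance C d
  hasDistance ind c c∈C c≢𝟎 = ℕ.≮⇒≥ λ ∣c∣<d → c≢𝟎
    (lookup-ext λ i → trans (ind c ∣c∣<d c c⊆c cb≈0 i) (sym (lookup-replicate i false)))
    where
    c⊆c : ∀ i → i ∉ c → lookup c i ≡ false
    c⊆c i i∉c = 𝔹.¬-not λ eq → i∉c (lookup⇒[]= i c eq)
    cb≈0 : ∀ s → apply (linearCombination (dual h) c b) s ≡ false
    cb≈0 s = trans (dual-combination c b s) (to (isParityCheck c) c∈C s)

  -- The T with b-sum f form the coset r + C.
  distance⇔rank : ∀ (f : LinearMap h) r → (∀ s → syndrome b r s ≡ apply f s) → ∀ j →
    (∃[ c ] (c ∈ Codeword C × hammingDistance r c ≡ j)) ⇔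
    (Σ[ T ∈ Subset n ] ((∀ s → apply (linearCombination (dual h) T b) s ≡ apply f s) × ∣ T ∣ ≡ j))
  distance⇔rank f r r↦f j = mk⇔
    (λ (c , c∈C , eq) → r ⊕ c , (λ s → begin
      apply (linearCombination (dual h) (r ⊕ c) b) s  ≡⟨ dual-combination (r ⊕ c) b s ⟩
      syndrome b (r ⊕ c) s                            ≡⟨ ⟪⟫-⊕ˡ _ r c ⟩
      syndrome b r s xor syndrome b c s               ≡⟨ cong₂ _xor_ (r↦f s) (to (isParityCheck c) c∈C s) ⟩
      apply f s xor false                             ≡⟨ 𝔹.xor-identityʳ (apply f s) ⟩
      apply f s                                       ∎) , eq)
    (λ (T , T↦f , eq) → r ⊕ T , from (isParityCheck (r ⊕ T)) (λ s → begin
      syndrome b (r ⊕ T) s               ≡⟨ ⟪⟫-⊕ˡ _ r T ⟩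
      syndrome b r s xor syndrome b T s
        ≡⟨ cong₂ _xor_ (r↦f s) (trans (sym (dual-combination T b s)) (T↦f s)) ⟩
      apply f s xor apply f s            ≡⟨ 𝔹.xor-same (apply f s) ⟩
      false                              ∎) ,
      trans (cong ∣_∣ (⊕-cancelˡ r T)) eq)
    where open ≡-Reasoning

  module _ (f : LinearMap h) (r : 𝔽₂^ n) (r↦f : ∀ s → syndrome b r s ≡ apply f s) (m : ℕ) where

    distance⇒rank : IsDistanceTo C r m → IsRank b f m
    distance⇒rank = IsMin-cong (distance⇔rank f r r↦f) m

    rank⇒distance : IsRank b f m → IsDistanceTo C r m
    rank⇒distance = IsMin-cong (λ j → let e = distance⇔rank f r r↦f j in mk⇔ (from e) (to e)) m

-- The two directions of the equivalence

CodeWithTester : (n k d : ℕ) (ε δ : ℝ) → Set₁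
CodeWithTester n k d ε δ =
  Σ[ C ∈ Code n ]
    (HasRate C k × HasDistance C d ×
     Σ[ 𝒯 ∈ LocalTester C ] (IsSmooth 𝒯 ε × HasSoundness 𝒯 δ))

CayleyGraphWithFamily : (n k d : ℕ) (ε δ : ℝ) → Set
CayleyGraphWithFamily n k d ε δ =
  Σ[ h ∈ ℕ ] Σ[ 𝒢 ∈ CayleyGraph h ] Σ[ b ∈ (Fin n → LinearMap h) ]
    (Spans (dual h) b U ×
     h ≡ n ∸ k ×
     WiseIndependent (dual h) d b ×
     (∀ i → 1ᴿ -ᴿ 2ᴿ *ᴿ ε ≤ᴿ eigenvalue 𝒢 (b i)) ×
     (∀ f m → IsRank b f m → eigenvalue 𝒢 f ≤ᴿ 1ᴿ -ᴿ 2ᴿ *ᴿ δ *ᴿ fromℕ m))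

code⇒cayley : ∀ n k d ε δ → CodeWithTester n k d ε δ → CayleyGraphWithFamily n k d ε δ
code⇒cayley n k d ε δ (C , (v , v∈C , v-ind , v-spans) , dist , 𝒯 , smooth , sound) =
  fromComplement (complement v v-ind)
  where
  fromComplement : ∃[ h ] (h ℕ.+ k ≡ n × Complement v h) → CayleyGraphWithFamily n k d ε δ
  fromComplement (h , h+k≡n , c) =
    h , 𝒢 , b , b-spans , h≡n∸k , wiseIndependent dist , b-smooth , b-sound
    where
    open Complement c
    open LocalTester 𝒯
    open ≡-Reasoning

    -- The parity-check matrix has the functionals `coord j` as rows; `b i` is its i-th column.
    b : Fin n → LinearMap h
    b i = functional (λ j → apply (coord j) ⁅ i ⁆)

    syndrome-coord : ∀ x s → syndrome b x s ≡ ⟪ s , (λ j → apply (coord j) x) ⟫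
    syndrome-coord x s = trans (⟪⟫-swap x s (λ i j → apply (coord j) ⁅ i ⁆))
      (⟪⟫-cong s (λ j → sym (apply-⟪⟫ (coord j) x)))

    kernel⊆C : ∀ x → (∀ j → apply (coord j) x ≡ false) → x ∈ Codeword C
    kernel⊆C x x∈ker =
      let a , av≡x = kernel⊆span x x∈ker
      in subst (Codeword C) av≡x (combination∈ (isSubspace C) v∈C a)

    isParityCheck : IsParityCheck b C
    isParityCheck x = mk⇔ C⊆kernel
      (λ x↦0 → kernel⊆C x λ j →
        trans (sym (⟪⟫-⁅⁆ j (λ j → apply (coord j) x))) (trans (sym (syndrome-coord x ⁅ j ⁆)) (x↦0 ⁅ j ⁆)))
      where
      C⊆kernel : x ∈ Codeword C → ∀ s → syndrome b x s ≡ false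
      C⊆kernel x∈C s =
        let a , av≡x = v-spans x x∈C
        in trans (syndrome-coord x s) (⟪⟫-zeroʳ s λ j →
             trans (cong (apply (coord j)) (sym av≡x))
               (trans (apply-combination (coord j) a v) (⟪⟫-zeroʳ a (coord-v j))))

    open ParityCheck C b isParityCheck

    h≡n∸k : h ≡ n ∸ k
    h≡n∸k = trans (sym (ℕ.m+n∸n≡m h k)) (cong (_∸ k) h+k≡n)

    b-spans : Spans (dual h) b U
    b-spans f _ = x , λ s → begin
      apply (linearCombination (dual h) x b) s  ≡⟨ dual-combination x b s ⟩
      syndrome b x s                            ≡⟨ syndrome-coord x s ⟩
      ⟪ s , (λ j → apply (coord j) x) ⟫         ≡⟨ ⟪⟫-cong s (λ j → trans (coord-combination j a)
                                                     (lookup∘tabulate (apply f ∘ ⁅_⁆) j)) ⟩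
      ⟪ s , apply f ∘ ⁅_⁆ ⟫                     ≡⟨ apply-⟪⟫ f s ⟨
      apply f s                                 ∎
      where
      -- Since `vec` is dual to `coord`, a word with any prescribed coordinates exists; the ones
      -- needed are the coefficients of f.
      a = tabulate (apply f ∘ ⁅_⁆)
      x = linearCombination (space n) a vec

    -- Duality of `vec` and `coord` makes this send (b₁(s), ..., bₙ(s)) back to s. It is defined off
    -- C^⊥ too, where the tester has probability `≈ᴿ` 0.
    ρ : 𝔽₂^ n → 𝔽₂^ h
    ρ α = tabulate (λ j → α · vec j)

    -- α annihilates C, hence does not distinguish r from its projection onto the complement.
    syndrome-ρ : ∀ r α → Dual C α → syndrome b r (ρ α) ≡ α · r
    syndrome-ρ r α α∈C⊥ = begin
      syndrome b r (ρ α)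
        ≡⟨ syndrome-coord r (ρ α) ⟩
      ⟪ ρ α , (λ j → apply (coord j) r) ⟫
        ≡⟨ ⟪⟫-cong (ρ α) (λ j → lookup∘tabulate (λ j → apply (coord j) r) j) ⟨
      ⟪ ρ α , lookup a ⟫
        ≡⟨ ·-⟪⟫ (ρ α) a ⟨
      ρ α · a
        ≡⟨ ·-comm (ρ α) a ⟩
      a · ρ α
        ≡⟨ ·-⟪⟫ a (ρ α) ⟩
      ⟪ a , lookup (ρ α) ⟫
        ≡⟨ ⟪⟫-cong a (λ j → trans (lookup∘tabulate (λ j → α · vec j) j) (·-functional (vec j))) ⟩
      ⟪ a , apply (functional (lookup α)) ∘ vec ⟫
        ≡⟨ apply-combination (functional (lookup α)) a vec ⟨
      apply (functional (lookup α)) y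
        ≡⟨ ·-functional y ⟨
      α · y
        ≡⟨ xor≡false⇒≡ (α · r) (α · y) (begin
             (α · r) xor (α · y)                    ≡⟨ cong₂ _xor_ (·-functional r) (·-functional y) ⟩
             ⟪ r , lookup α ⟫ xor ⟪ y , lookup α ⟫  ≡⟨ ⟪⟫-⊕ˡ (lookup α) r y ⟨
             ⟪ r ⊕ y , lookup α ⟫                   ≡⟨ ·-functional (r ⊕ y) ⟨
             α · (r ⊕ y)                            ≡⟨ α∈C⊥ (r ⊕ y) (kernel⊆C (r ⊕ y) coord-r⊕y) ⟩
             false                                  ∎) ⟨
      α · r ∎
      where
      a = tabulate (λ j → apply (coord j) r)
      y = linearCombination (space n) a vec
      ·-functional : ∀ x → α · x ≡ ⟪ x , lookup α ⟫
      ·-functional x = trans (·-comm α x) (·-⟪⟫ x α)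
      coord-r⊕y : ∀ j → apply (coord j) (r ⊕ y) ≡ false
      coord-r⊕y j = trans (+ᴹ-homo (coord j) r y)
        (trans (cong (apply (coord j) r xor_)
                 (trans (coord-combination j a) (lookup∘tabulate (λ j → apply (coord j) r) j)))
               (𝔹.xor-same (apply (coord j) r)))

    open Pushforward ρ 𝒟₀

    𝒢 : CayleyGraph h
    𝒢 = Cay pushforward

    b-smooth : ∀ i → 1ᴿ -ᴿ 2ᴿ *ᴿ ε ≤ᴿ eigenvalue 𝒢 (b i)
    b-smooth i = to (Pr≤⇔≤eigenvalue 𝒢 (b i) ε)
      (≤ᴿ-trans (Pr pushforward (apply (b i))) (Pr 𝒟₀ (λ α → lookup α i)) ε
        -- The case r = `⁅ i ⁆` of `syndrome-ρ`: the syndrome of a unit vector is `b i`.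
        (Pr-pushforward-≤ (apply (b i)) (λ α → lookup α i) λ α neq → supported α λ α∈C⊥ → neq
          (trans (sym (⟪⟫-⁅⁆ i (λ i → apply (b i) (ρ α))))
            (trans (syndrome-ρ ⁅ i ⁆ α α∈C⊥) (trans (·-⟪⟫ α ⁅ i ⁆) (⟪⟫-lookup-⁅⁆ α i)))))
        (smooth i))

    b-sound : ∀ f m → IsRank b f m → eigenvalue 𝒢 f ≤ᴿ 1ᴿ -ᴿ 2ᴿ *ᴿ δ *ᴿ fromℕ m
    -- The set T attaining the rank serves as the word r to be tested, since its syndrome is f.
    b-sound f m isRank@((T , T↦f , _) , _) = to (≤Pr⇔eigenvalue≤ 𝒢 f δ (fromℕ m))
      (≤ᴿ-trans (δ *ᴿ fromℕ m) (Pr 𝒟₀ (λ α → α · T)) (Pr pushforward (apply f))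
        (sound T m (rank⇒distance f T T↦f′ m isRank))
        (Pr-pushforward-≥ (apply f) (λ α → α · T) λ α neq → supported α λ α∈C⊥ → neq
          (trans (sym (syndrome-ρ T α α∈C⊥)) (T↦f′ (ρ α)))))
      where
      T↦f′ : ∀ s → syndrome b T s ≡ apply f s
      T↦f′ s = trans (sym (dual-combination T b s)) (T↦f s)

cayley⇒code : ∀ n k d ε δ → k ≤ n → CayleyGraphWithFamily n k d ε δ → CodeWithTester n k d ε δ
cayley⇒code n k d ε δ k≤n (h , 𝒢 , b , b-spans , h≡n∸k , wise , b-smooth , b-sound) =
  C , rate , hasDistance wise , 𝒯 , smooth , sound
  where
  open ≡-Reasoning

  -- The j-th row of the matrix: `apply (σ j) x` is `syndrome b x ⁅ j ⁆` by definition.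
  σ : Fin h → LinearMap n
  σ j = functional (λ i → apply (b i) ⁅ j ⁆)

  -- Writing each coordinate functional as a combination of the `b i` yields a right inverse of the
  -- matrix, which witnesses full rank.
  u : Fin h → 𝔽₂^ n
  u j = proj₁ (b-spans (coordinate j) _)

  σ-u : ∀ i j → apply (σ i) (u j) ≡ lookup ⁅ i ⁆ j
  σ-u i j = trans (sym (dual-combination (u j) b ⁅ i ⁆)) (proj₂ (b-spans (coordinate j) _) ⁅ i ⁆)

  C : Code n
  C = record { Codeword = Kernel σ ; isSubspace = Kernel-isSubspace σ }

  rate : HasRate C k
  rate =
    let k′ , k′+h≡n , dimension = kernel-dimension σ u σ-u
    in subst (HasRate C) (begin
      k′            ≡⟨ ℕ.m+n∸n≡m k′ h ⟨
      k′ ℕ.+ h ∸ h  ≡⟨ cong₂ _∸_ k′+h≡n h≡n∸k ⟩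
      -- Subtraction is truncated, so k ≤ n is what recovers k from h.
      n ∸ (n ∸ k)   ≡⟨ ℕ.m∸[m∸n]≡n k≤n ⟩
      k             ∎) dimension

  isParityCheck : IsParityCheck b C
  isParityCheck x = mk⇔
    (λ x∈C s → begin
      syndrome b x s                            ≡⟨ dual-combination x b s ⟨
      apply (linearCombination (dual h) x b) s  ≡⟨ apply-⟪⟫ (linearCombination (dual h) x b) s ⟩
      ⟪ s , apply (linearCombination (dual h) x b) ∘ ⁅_⁆ ⟫
        ≡⟨ ⟪⟫-zeroʳ s (λ j → trans (dual-combination x b ⁅ j ⁆) (x∈C j)) ⟩
      false                                     ∎)
    (λ x↦0 j → x↦0 ⁅ j ⁆)

  open ParityCheck C b isParityCheck

  ρ : 𝔽₂^ h → 𝔽₂^ n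
  ρ s = tabulate (λ i → apply (b i) s)

  ρ-· : ∀ s x → ρ s · x ≡ syndrome b x s
  ρ-· s x = trans (·-comm (ρ s) x)
    (trans (·-⟪⟫ x (ρ s)) (⟪⟫-cong x (lookup∘tabulate (λ i → apply (b i) s))))

  open Pushforward ρ (𝒟 𝒢)

  𝒯 : LocalTester C
  𝒯 = record
    { 𝒟₀        = pushforward
    -- Every `ρ s` annihilates C, so a vector outside C^⊥ has an empty fibre.
    ; supported = λ α α∉C⊥ → pushProb-off-image α λ s ρs≡α → α∉C⊥ λ c c∈C →
        trans (cong (_· c) (sym ρs≡α)) (trans (ρ-· s c) (to (isParityCheck c) c∈C s))
    }

  smooth : IsSmooth 𝒯 ε
  smooth i = ≤ᴿ-trans (Pr pushforward (λ α → lookup α i)) (Pr (𝒟 𝒢) (apply (b i))) ε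
    (Pr-pushforward-≤ (λ α → lookup α i) (apply (b i))
      λ s neq → contradiction (lookup∘tabulate (λ i → apply (b i) s) i) neq)
    (from (Pr≤⇔≤eigenvalue 𝒢 (b i) ε) (b-smooth i))

  sound : HasSoundness 𝒯 δ
  sound r m isDistance =
    ≤ᴿ-trans (δ *ᴿ fromℕ m) (Pr (𝒟 𝒢) (apply f)) (Pr pushforward (λ α → α · r))
      (from (≤Pr⇔eigenvalue≤ 𝒢 f δ (fromℕ m))
        (b-sound f m (distance⇒rank f r (λ s → sym (dual-combination r b s)) m isDistance)))
      (Pr-pushforward-≥ (λ α → α · r) (apply f) λ s neq →
        contradiction (trans (dual-combination r b s) (sym (ρ-· s r))) neq)
    where
    -- The syndrome of r as a linear map: its rank is d(r, C), and f(s) = `ρ s · r` for every s,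
    -- with no null outcomes to discard.
    f = linearCombination (dual h) r b

theorem4 : ∀ (n k d : ℕ) (ε δ : ℝ) →
    1 ≤ n → k ≤ n → 1 ≤ d → 0ᴿ ≤ᴿ ε → 0ᴿ <ᴿ δ →
    (Σ[ C ∈ Code n ]
    (HasRate C k × HasDistance C d ×
    Σ[ 𝒯 ∈ LocalTester C ] (IsSmooth 𝒯 ε × HasSoundness 𝒯 δ)))
    ⇔
    (Σ[ h ∈ ℕ ] Σ[ 𝒢 ∈ CayleyGraph h ] Σ[ b ∈ (Fin n → LinearMap h) ]
    (Spans (dual h) b U ×
    h ≡ n ∸ k ×
    WiseIndependent (dual h) d b ×
    (∀ i → 1ᴿ -ᴿ 2ᴿ *ᴿ ε ≤ᴿ eigenvalue 𝒢 (b i)) ×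
    (∀ f m → IsRank b f m → eigenvalue 𝒢 f ≤ᴿ 1ᴿ -ᴿ 2ᴿ *ᴿ δ *ᴿ fromℕ m)))
theorem4 n k d ε δ _ k≤n _ _ _ =
  mk⇔ (code⇒cayley n k d ε δ) (cayley⇒code n k d ε δ k≤n)
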